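{- The following two statements are equivalent. (1) The class of first-order spectra is closed under complement, i.e. for every first-order sentence $\varphi$ the set $\{1,2,3,\ldots\}\setminus \mathrm{Spec}(\varphi)$ is a spectrum. (2) For every first-order sentence $\varphi$ that uses only three variables and whose finite models are all undirected bipartite graphs, the set $\{1,2,3,\ldots\}\setminus\mathrm{Spec}(\varphi)$ is a spectrum.
   Context: The spectrum $\mathrm{Spec}(\varphi)$ of a first-order sentence $\varphi$ (with equality, over an arbitrary finite vocabulary) is the set of cardinalities of its finite models (structures have nonempty domain). A set of positive integers is called a spectrum if it equals $\mathrm{Spec}(\varphi)$ for some first-order sentence $\varphi$. A sentence uses only three variables if all variables occurring in it (free or bound) are among three fixed variable symbols; variables may be re-quantified and reused. A sentence whose finite models are all undirected bipartite graphs is a sentence over a single binary relation symbol $E$ such that in every finite model $E$ is interpreted as a symmetric relation and the domain can be split into two disjoint parts such that every edge joins elements of different parts. -}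

module Defs where

open import Level using (Level; 0ℓ; _⊔_) renaming (suc to lsuc)
open import Data.Bool using (Bool; T; if_then_else_)
open import Data.Fin using (Fin; zero)
open import Data.Nat using (ℕ; _≤_; _<_; _≟_)
open import Data.Product using (Σ; ∃; _×_)
open import Data.Sum using (_⊎_)
open import Data.Vec using (Vec; []; _∷_)
open import Data.Vec.Relation.Unary.Any using (Any)
open import Function.Bundles using (_↔_)
open import Relation.Binary using (Rel; Symmetric)
open import Relation.Binary.PropositionalEquality using (_≡_; _≢_)
open import Relation.Nullary using (¬_; does)
open import Relation.Unary using (Pred; _≐_; _∖_)

-- Constants are function symbols of arity 0; relation symbols of arity 0
-- are allowed as well.
record Vocabulary : Set where
  field
    #rel     : ℕ
    relArity : Fin #rel → ℕ
    #fun     : ℕ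
    funArity : Fin #fun → ℕ

open Vocabulary public

-- Variables are names, not de Bruijn indices, so that a variable can be
-- quantified again inside its own scope.
Var : Set
Var = ℕ

data Term (σ : Vocabulary) : Set where
  var : Var → Term σ
  app : (f : Fin (#fun σ)) → Vec (Term σ) (funArity σ f) → Term σ

infix  8 _≈′_
infix  7 ¬′_
infixr 6 _∧′_
infixr 5 _∨′_

data Formula (σ : Vocabulary) : Set where
  _≈′_  : Term σ → Term σ → Formula σ
  rel   : (r : Fin (#rel σ)) → Vec (Term σ) (relArity σ r) → Formula σ
  ¬′_   : Formula σ → Formula σ
  _∧′_  : Formula σ → Formula σ → Formula σ
  _∨′_  : Formula σ → Formula σ → Formula σ
  all′  : Var → Formula σ → Formula σ
  ex′   : Var → Formula σ → Formula σ

data _∈ᵗ_ {σ : Vocabulary} (x : Var) : Term σ → Set where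
  here  : x ∈ᵗ var x
  there : ∀ {f} {ts : Vec (Term σ) (funArity σ f)} →
          Any (x ∈ᵗ_) ts → x ∈ᵗ app f ts

_OccursIn_ : {σ : Vocabulary} → Var → Formula σ → Set
x OccursIn (s ≈′ t)  = x ∈ᵗ s ⊎ x ∈ᵗ t
x OccursIn rel r ts  = Any (x ∈ᵗ_) ts
x OccursIn (¬′ φ)    = x OccursIn φ
x OccursIn (φ ∧′ ψ)  = x OccursIn φ ⊎ x OccursIn ψ
x OccursIn (φ ∨′ ψ)  = x OccursIn φ ⊎ x OccursIn ψ
x OccursIn all′ y φ  = x ≡ y ⊎ x OccursIn φ
x OccursIn ex′ y φ   = x ≡ y ⊎ x OccursIn φ

_FreeIn_ : {σ : Vocabulary} → Var → Formula σ → Set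
x FreeIn (s ≈′ t)  = x ∈ᵗ s ⊎ x ∈ᵗ t
x FreeIn rel r ts  = Any (x ∈ᵗ_) ts
x FreeIn (¬′ φ)    = x FreeIn φ
x FreeIn (φ ∧′ ψ)  = x FreeIn φ ⊎ x FreeIn ψ
x FreeIn (φ ∨′ ψ)  = x FreeIn φ ⊎ x FreeIn ψ
x FreeIn all′ y φ  = x ≢ y × x FreeIn φ
x FreeIn ex′ y φ   = x ≢ y × x FreeIn φ

record Sentence (σ : Vocabulary) : Set where
  field
    formula : Formula σ
    closed  : ∀ x → ¬ (x FreeIn formula)

open Sentence public

-- Only finite structures matter here, and classically every relation on a
-- finite set is decidable, so relations are Bool-valued.
record Structure (σ : Vocabulary) : Set₁ where
  field
    Carrier  : Set
    nonempty : Carrier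
    relᴹ     : (r : Fin (#rel σ)) → Vec Carrier (relArity σ r) → Bool
    funᴹ     : (f : Fin (#fun σ)) → Vec Carrier (funArity σ f) → Carrier

open Structure public

HasCardinality : {σ : Vocabulary} → Structure σ → ℕ → Set
HasCardinality M n = Carrier M ↔ Fin n

Finite : {σ : Vocabulary} → Structure σ → Set
Finite M = ∃ λ n → HasCardinality M n

module _ {σ : Vocabulary} (M : Structure σ) where

  Assignment : Set
  Assignment = Var → Carrier M

  _[_↦_] : Assignment → Var → Carrier M → Assignment
  (ρ [ x ↦ a ]) y = if does (x ≟ y) then a else ρ y

  mutual
    ⟦_⟧ : Term σ → Assignment → Carrier M
    ⟦ var x ⟧ ρ    = ρ x
    ⟦ app f ts ⟧ ρ = funᴹ M f (⟦ ts ⟧* ρ)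

    ⟦_⟧* : ∀ {k} → Vec (Term σ) k → Assignment → Vec (Carrier M) k
    ⟦ [] ⟧* ρ     = []
    ⟦ t ∷ ts ⟧* ρ = ⟦ t ⟧ ρ ∷ ⟦ ts ⟧* ρ

  -- In a finite structure every clause is decidable, so there the
  -- constructive readings of ⊎, Σ and Π agree with the classical ones.
  Sat : Assignment → Formula σ → Set
  Sat ρ (s ≈′ t)   = ⟦ s ⟧ ρ ≡ ⟦ t ⟧ ρ
  Sat ρ (rel r ts) = T (relᴹ M r (⟦ ts ⟧* ρ))
  Sat ρ (¬′ φ)     = ¬ Sat ρ φ
  Sat ρ (φ ∧′ ψ)   = Sat ρ φ × Sat ρ ψ
  Sat ρ (φ ∨′ ψ)   = Sat ρ φ ⊎ Sat ρ ψ
  Sat ρ (all′ x φ) = (a : Carrier M) → Sat (ρ [ x ↦ a ]) φ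
  Sat ρ (ex′ x φ)  = Σ (Carrier M) λ a → Sat (ρ [ x ↦ a ]) φ

-- The truth of a sentence does not depend on the assignment.
_⊨_ : {σ : Vocabulary} → Structure σ → Sentence σ → Set
M ⊨ φ = (ρ : Assignment M) → Sat M ρ (formula φ)

Spec : {σ : Vocabulary} → Sentence σ → Pred ℕ (lsuc 0ℓ)
Spec {σ} φ n = Σ (Structure σ) λ M → HasCardinality M n × M ⊨ φ

IsSpectrum : {ℓ : Level} → Pred ℕ ℓ → Set (lsuc 0ℓ ⊔ ℓ)
IsSpectrum S = Σ Vocabulary λ σ → Σ (Sentence σ) λ φ → S ≐ Spec φ

CoSpec : {σ : Vocabulary} → Sentence σ → Pred ℕ (lsuc 0ℓ)
CoSpec φ = (1 ≤_) ∖ Spec φ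

-- The three fixed variable symbols are 0, 1 and 2.
ThreeVariable : {σ : Vocabulary} → Sentence σ → Set
ThreeVariable φ = ∀ x → x OccursIn formula φ → x < 3

graphVocabulary : Vocabulary
graphVocabulary = record
  { #rel = 1 ; relArity = λ _ → 2 ; #fun = 0 ; funArity = λ () }

Edge : (M : Structure graphVocabulary) → Rel (Carrier M) 0ℓ
Edge M a b = T (relᴹ M zero (a ∷ b ∷ []))

-- A splitting of the domain into two disjoint parts, either of which may be
-- empty, is given by its characteristic function.
Bipartite : Structure graphVocabulary → Set
Bipartite M = Σ (Carrier M → Bool) λ side →
  ∀ a b → Edge M a b → side a ≢ side b

IsUndirectedBipartiteGraph : Structure graphVocabulary → Set
IsUndirectedBipartiteGraph M = Symmetric (Edge M) × Bipartite M

FiniteModelsAreBipartiteGraphs : Sentence graphVocabulary → Set₁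
FiniteModelsAreBipartiteGraphs φ =
  (M : Structure graphVocabulary) → Finite M → M ⊨ φ →
  IsUndirectedBipartiteGraph M

{-# OPTIONS --safe #-}

-- For every sentence φ there are k, c ≥ 1 and a three-variable sentence φ′ with
-- bipartite models such that n ∈ Spec φ iff nᵏ c ∈ Spec φ′.  The vertices of
-- the graph are k-tuples over a model of φ, each with a gadget of c vertices; a
-- tuple represents an assignment, so that one graph variable replaces k
-- variables of φ, and walking in the graph is relational composition, which
-- needs three variables.  Conversely {n | nᵏ c ∈ Spec ψ} is a spectrum for every
-- ψ: by the above ψ may be taken over graphs, at the cost of another k and c,
-- and a graph on nᵏ c vertices is described by relations of arity 2k on n
-- points.  Now if (2) holds, the complement of Spec φ is
-- {n ≥ 1 | nᵏ c ∉ Spec φ′}, where the complement of Spec φ′ is some Spec ψ.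

module Submission where

open import Defs
open import Data.Bool using (Bool; true; false; T; not)
open import Data.Bool.Properties using (T?; T-irrelevant; not-involutive)
open import Data.Empty using (⊥-elim)
open import Data.Fin using (Fin; zero; suc; toℕ; fromℕ<; inject≤; punchIn; punchOut; _↑ˡ_; _↑ʳ_; splitAt; combine; remQuot)
import Data.Fin as Fin
open import Data.Fin.Permutation using (↔⇒≡)
open import Data.Fin.Properties using (any?; all?; inj⇒≟; toℕ-fromℕ<; fromℕ<-toℕ; toℕ-inject≤; toℕ<n; toℕ-injective; punchIn-punchOut; punchInᵢ≢i; splitAt-↑ˡ; splitAt-↑ʳ; remQuot-combine; +↔⊎; *↔×)
open import Data.Nat using (ℕ; zero; suc; pred; _+_; _*_; _^_; _⊔_; _≤_; _<_; _<?_; _≟_; z≤n; s≤s)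
import Data.Nat.Properties as ℕ
open import Data.Product using (Σ; ∃; _×_; _,_; proj₁; proj₂; uncurry)
open import Data.Product.Function.NonDependent.Propositional using (_×-↔_)
open import Data.Product.Properties using (,-injective)
open import Data.Sum as Sum using (_⊎_; inj₁; inj₂; [_,_])
open import Data.Sum.Function.Propositional using (_⊎-↔_)
open import Data.Unit using (⊤; tt)
open import Data.Vec using (Vec; []; _∷_; _++_; head; uncons; lookup; tabulate; replicate; take; drop; _[_]≔_)
open import Data.Vec.Properties using (≡-dec; lookup∘tabulate; tabulate∘lookup; tabulate-cong; lookup∘update; lookup∘update′; lookup-replicate; ++-injective; take++drop≡id)
open import Data.Vec.Relation.Unary.Any using (Any; here; there)
open import Data.Vec.Relation.Unary.Any.Properties using (++⁻)
open import Function using (_∘_; id; case_of_)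
open import Function.Bundles using (_↔_; _⇔_; mk⇔; mk↔ₛ′; Inverse; Equivalence)
open import Function.Properties.Inverse using (↔⇒↣; ↔-refl; ↔-sym; ↔-trans)
open import Relation.Binary using (Decidable; DecidableEquality)
open import Relation.Binary.Definitions using (tri<; tri≈; tri>)
open import Relation.Binary.PropositionalEquality hiding ([_])
open import Relation.Nullary using (¬_; Dec; yes; no; ¬?; _×-dec_; _⊎-dec_; _→-dec_)
open import Relation.Nullary.Decidable using (map′; decidable-stable; dec-true; dec-false; isYes; toWitness; fromWitness)
open Equivalence using (to; from)

-- The graph has to carry many relations on a single edge symbol, without labels or directions. Each
-- symbol of the vocabulary therefore becomes a position in the gadget at which cross edges leave.
-- These positions must be definable with three variables, and path edges and cross edges must
-- respect one common 2-colouring; this dictates the shape and the numbering of the gadget.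
-- Quantifying the variable i of φ becomes a step between tuples that agree in all other entries.
-- Decoding rests on the axioms alone: a finite model of them may look unlike the graphs built from
-- structures and still yields a structure. The axioms also determine its number of vertices, and as
-- n ↦ nᵏ c is injective for k, c ≥ 1, the size of the decoded structure is the right one. Classical
-- steps are available because everything is decidable over a finite carrier.

private variable
  m n r : ℕ
  σ : Vocabulary
  X : Set

-- Decidability over finite carriers.

finite-≟ : X ↔ Fin n → DecidableEquality X
finite-≟ F = inj⇒≟ (↔⇒↣ F)

finite-any? : X ↔ Fin n → {P : X → Set} → (∀ a → Dec (P a)) → Dec (∃ P)
finite-any? F {P} P? = map′
  (λ (i , p) → Inverse.from F i , p)
  (λ (a , p) → Inverse.to F a , subst P (sym (Inverse.strictlyInverseʳ F a)) p)
  (any? (λ i → P? (Inverse.from F i)))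

-- Calculus of relations and three-variable formulas.

-- Three-variable logic over one binary relation is the calculus of relations,
-- so sentences are written in that calculus and translated at the end.
infix  9 _ᶜ _˘
infixr 8 _⨾_
infixr 7 _∩_
infixr 6 _∪_
infixr 5 _⇒_

data RelExpr : Set where
  E I 𝟙       : RelExpr
  _ᶜ _˘       : RelExpr → RelExpr
  _∩_ _∪_ _⇒_ : RelExpr → RelExpr → RelExpr
  _⨾_         : RelExpr → RelExpr → RelExpr
  ⋂ ⋃         : (Fin n → RelExpr) → RelExpr

module RelSemantics {V : Set} (edge : V → V → Set) where

  infix 4 _⊩_
  _⊩_ : V × V → RelExpr → Set
  (x , y) ⊩ E       = edge x y
  (x , y) ⊩ I       = x ≡ y
  (x , y) ⊩ 𝟙       = ⊤
  (x , y) ⊩ R ᶜ     = ¬ (x , y) ⊩ R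
  (x , y) ⊩ R ˘     = (y , x) ⊩ R
  (x , y) ⊩ (R ∩ S) = (x , y) ⊩ R × (x , y) ⊩ S
  (x , y) ⊩ (R ∪ S) = (x , y) ⊩ R ⊎ (x , y) ⊩ S
  (x , y) ⊩ (R ⇒ S) = (x , y) ⊩ R → (x , y) ⊩ S
  (x , y) ⊩ (R ⨾ S) = ∃ λ z → (x , z) ⊩ R × (z , y) ⊩ S
  (x , y) ⊩ ⋂ R     = ∀ i → (x , y) ⊩ R i
  (x , y) ⊩ ⋃ R     = ∃ λ i → (x , y) ⊩ R i

  module _ (F : V ↔ Fin n) (edge? : Decidable edge) where

    ⊩? : ∀ R x y → Dec ((x , y) ⊩ R)
    ⊩? E       x y = edge? x y
    ⊩? I       x y = finite-≟ F x y
    ⊩? 𝟙       x y = yes tt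
    ⊩? (R ᶜ)   x y = ¬? (⊩? R x y)
    ⊩? (R ˘)   x y = ⊩? R y x
    ⊩? (R ∩ S) x y = ⊩? R x y ×-dec ⊩? S x y
    ⊩? (R ∪ S) x y = ⊩? R x y ⊎-dec ⊩? S x y
    ⊩? (R ⇒ S) x y = ⊩? R x y →-dec ⊩? S x y
    ⊩? (R ⨾ S) x y = finite-any? F λ z → ⊩? R x z ×-dec ⊩? S z y
    ⊩? (⋂ R)   x y = all? λ i → ⊩? (R i) x y
    ⊩? (⋃ R)   x y = any? λ i → ⊩? (R i) x y

tautology : Var → Formula σ
tautology x = var x ≈′ var x

conjunction disjunction : Var → (Fin n → Formula σ) → Formula σ
conjunction {zero}  x φ = tautology x
conjunction {suc n} x φ = φ zero ∧′ conjunction x (φ ∘ suc)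
disjunction {zero}  x φ = ¬′ tautology x
disjunction {suc n} x φ = φ zero ∨′ disjunction x (φ ∘ suc)

module _ {M : Structure σ} {ρ : Assignment M} where

  Sat-conjunction : ∀ {x} (φ : Fin n → Formula σ) →
    Sat M ρ (conjunction x φ) ⇔ (∀ i → Sat M ρ (φ i))
  Sat-conjunction {n = zero}  φ = mk⇔ (λ _ ()) (λ _ → refl)
  Sat-conjunction {n = suc n} φ = mk⇔
    (λ { (p , q) zero → p ; (p , q) (suc i) → to (Sat-conjunction (φ ∘ suc)) q i })
    (λ p → p zero , from (Sat-conjunction (φ ∘ suc)) (p ∘ suc))

  Sat-disjunction : ∀ {x} (φ : Fin n → Formula σ) →
    Sat M ρ (disjunction x φ) ⇔ (∃ λ i → Sat M ρ (φ i))
  Sat-disjunction {n = zero}  φ = mk⇔ (λ p → ⊥-elim (p refl)) (λ ())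
  Sat-disjunction {n = suc n} φ = mk⇔
    (λ { (inj₁ p) → zero , p
       ; (inj₂ p) → let i , q = to (Sat-disjunction (φ ∘ suc)) p in suc i , q })
    (λ { (zero , p) → inj₁ p
       ; (suc i , p) → inj₂ (from (Sat-disjunction (φ ∘ suc)) (i , p)) })

module _ (M : Structure σ) (ρ : Assignment M) where

  update-same : ∀ x a → _[_↦_] M ρ x a x ≡ a
  update-same x a rewrite dec-true (x ≟ x) refl = refl

  update-other : ∀ {x y} a → x ≢ y → _[_↦_] M ρ x a y ≡ ρ y
  update-other {x} {y} a x≢y rewrite dec-false (x ≟ y) x≢y = refl

-- The third variable is the one that may be quantified anew.
formula³ : RelExpr → Var → Var → Var → Formula graphVocabulary
formula³ E       u v w = rel zero (var u ∷ var v ∷ [])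
formula³ I       u v w = var u ≈′ var v
formula³ 𝟙       u v w = tautology u
formula³ (R ᶜ)   u v w = ¬′ formula³ R u v w
formula³ (R ˘)   u v w = formula³ R v u w
formula³ (R ∩ S) u v w = formula³ R u v w ∧′ formula³ S u v w
formula³ (R ∪ S) u v w = formula³ R u v w ∨′ formula³ S u v w
formula³ (R ⇒ S) u v w = ¬′ formula³ R u v w ∨′ formula³ S u v w
formula³ (R ⨾ S) u v w = ex′ w (formula³ R u w v ∧′ formula³ S w v u)
formula³ (⋂ R)   u v w = conjunction u λ i → formula³ (R i) u v w
formula³ (⋃ R)   u v w = disjunction u λ i → formula³ (R i) u v w

Edge? : (G : Structure graphVocabulary) → Decidable (Edge G)
Edge? G a b = T? _

module _ (G : Structure graphVocabulary) (F : Finite G) where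
  open RelSemantics (Edge G)

  -- In a composition the intermediate point takes the spare variable. Each factor mentions only one
  -- of the two old points, so inside it the variable of the other becomes the spare one. Hence
  -- three names suffice at every depth of nesting.
  Sat-formula³ : ∀ R {u v w} → u ≢ v → u ≢ w → v ≢ w → ∀ ρ →
    Sat G ρ (formula³ R u v w) ⇔ (ρ u , ρ v) ⊩ R
  Sat-formula³ E u≢v u≢w v≢w ρ = mk⇔ id id
  Sat-formula³ I u≢v u≢w v≢w ρ = mk⇔ id id
  Sat-formula³ 𝟙 u≢v u≢w v≢w ρ = mk⇔ _ (λ _ → refl)
  Sat-formula³ (R ᶜ) u≢v u≢w v≢w ρ =
    let s = Sat-formula³ R u≢v u≢w v≢w ρ in mk⇔ (_∘ from s) (_∘ to s)
  Sat-formula³ (R ˘) u≢v u≢w v≢w ρ = Sat-formula³ R (≢-sym u≢v) v≢w u≢w ρ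
  Sat-formula³ (R ∩ S) u≢v u≢w v≢w ρ =
    let r = Sat-formula³ R u≢v u≢w v≢w ρ
        s = Sat-formula³ S u≢v u≢w v≢w ρ
    in mk⇔ (λ (p , q) → to r p , to s q) (λ (p , q) → from r p , from s q)
  Sat-formula³ (R ∪ S) u≢v u≢w v≢w ρ =
    let r = Sat-formula³ R u≢v u≢w v≢w ρ
        s = Sat-formula³ S u≢v u≢w v≢w ρ
    in mk⇔ (Sum.map (to r) (to s)) (Sum.map (from r) (from s))
  Sat-formula³ (R ⇒ S) {u} {v} u≢v u≢w v≢w ρ =
    let r = Sat-formula³ R u≢v u≢w v≢w ρ
        s = Sat-formula³ S u≢v u≢w v≢w ρ
    in mk⇔ [ (λ ¬p p → ⊥-elim (¬p (from r p))) , (λ q _ → to s q) ]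
           (λ f → case ⊩? (proj₂ F) (Edge? G) R (ρ u) (ρ v) of λ where
              (yes p) → inj₂ (from s (f p))
              (no ¬p) → inj₁ (¬p ∘ to r))
  Sat-formula³ (R ⨾ S) {u} {v} {w} u≢v u≢w v≢w ρ =
    mk⇔ (λ (a , p , q) → a , to (first a) p , to (second a) q)
        (λ (a , p , q) → a , from (first a) p , from (second a) q)
    where
    first : ∀ a → Sat G (_[_↦_] G ρ w a) (formula³ R u w v) ⇔ (ρ u , a) ⊩ R
    first a = subst₂ (λ x y → Sat G (_[_↦_] G ρ w a) (formula³ R u w v) ⇔ (x , y) ⊩ R)
      (update-other G ρ a (≢-sym u≢w)) (update-same G ρ w a)
      (Sat-formula³ R u≢w u≢v (≢-sym v≢w) (_[_↦_] G ρ w a))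
    second : ∀ a → Sat G (_[_↦_] G ρ w a) (formula³ S w v u) ⇔ (a , ρ v) ⊩ S
    second a = subst₂ (λ x y → Sat G (_[_↦_] G ρ w a) (formula³ S w v u) ⇔ (x , y) ⊩ S)
      (update-same G ρ w a) (update-other G ρ a (≢-sym v≢w))
      (Sat-formula³ S (≢-sym v≢w) (≢-sym u≢w) (≢-sym u≢v) (_[_↦_] G ρ w a))
  Sat-formula³ (⋂ R) u≢v u≢w v≢w ρ =
    let s = λ i → Sat-formula³ (R i) u≢v u≢w v≢w ρ
        c = Sat-conjunction _
    in mk⇔ (λ p i → to (s i) (to c p i)) (λ p → from c λ i → from (s i) (p i))
  Sat-formula³ (⋃ R) u≢v u≢w v≢w ρ =
    let s = λ i → Sat-formula³ (R i) u≢v u≢w v≢w ρ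
        c = Sat-disjunction _
    in mk⇔ (λ p → let i , q = to c p in i , to (s i) q)
           (λ (i , q) → from c (i , from (s i) q))

FreeIn⇒OccursIn : ∀ {x} (φ : Formula σ) → x FreeIn φ → x OccursIn φ
FreeIn⇒OccursIn (s ≈′ t)   f        = f
FreeIn⇒OccursIn (rel r ts) f        = f
FreeIn⇒OccursIn (¬′ φ)     f        = FreeIn⇒OccursIn φ f
FreeIn⇒OccursIn (φ ∧′ ψ)   (inj₁ f) = inj₁ (FreeIn⇒OccursIn φ f)
FreeIn⇒OccursIn (φ ∧′ ψ)   (inj₂ f) = inj₂ (FreeIn⇒OccursIn ψ f)
FreeIn⇒OccursIn (φ ∨′ ψ)   (inj₁ f) = inj₁ (FreeIn⇒OccursIn φ f)
FreeIn⇒OccursIn (φ ∨′ ψ)   (inj₂ f) = inj₂ (FreeIn⇒OccursIn ψ f)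
FreeIn⇒OccursIn (all′ y φ) (_ , f)  = inj₂ (FreeIn⇒OccursIn φ f)
FreeIn⇒OccursIn (ex′ y φ)  (_ , f)  = inj₂ (FreeIn⇒OccursIn φ f)

module _ {P : Var → Set} {x u : Var} (Pu : P u) where

  tautology-occurs : x OccursIn (tautology {σ} u) → P x
  tautology-occurs (inj₁ here) = Pu
  tautology-occurs (inj₂ here) = Pu

  conjunction-occurs : (φ : Fin n → Formula σ) →
    (∀ i → x OccursIn φ i → P x) → x OccursIn conjunction u φ → P x
  conjunction-occurs {n = zero}  φ h o        = tautology-occurs o
  conjunction-occurs {n = suc n} φ h (inj₁ o) = h zero o
  conjunction-occurs {n = suc n} φ h (inj₂ o) = conjunction-occurs (φ ∘ suc) (h ∘ suc) o

  disjunction-occurs : (φ : Fin n → Formula σ) →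
    (∀ i → x OccursIn φ i → P x) → x OccursIn disjunction u φ → P x
  disjunction-occurs {n = zero}  φ h o        = tautology-occurs o
  disjunction-occurs {n = suc n} φ h (inj₁ o) = h zero o
  disjunction-occurs {n = suc n} φ h (inj₂ o) = disjunction-occurs (φ ∘ suc) (h ∘ suc) o

-- With an arbitrary `P` in place of a list of names, the recursion may permute the three variables
-- freely; the use is `P` = `_< 3`.
formula³-occurs : ∀ {P : Var → Set} R {x u v w} → P u → P v → P w →
  x OccursIn formula³ R u v w → P x
formula³-occurs E       Pu Pv Pw (here here)         = Pu
formula³-occurs E       Pu Pv Pw (there (here here)) = Pv
formula³-occurs I       Pu Pv Pw (inj₁ here) = Pu
formula³-occurs I       Pu Pv Pw (inj₂ here) = Pv
formula³-occurs {P} 𝟙   Pu Pv Pw o           = tautology-occurs {P = P} Pu {graphVocabulary} o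
formula³-occurs (R ᶜ)   Pu Pv Pw o           = formula³-occurs R Pu Pv Pw o
formula³-occurs (R ˘)   Pu Pv Pw o           = formula³-occurs R Pv Pu Pw o
formula³-occurs (R ∩ S) Pu Pv Pw (inj₁ o)    = formula³-occurs R Pu Pv Pw o
formula³-occurs (R ∩ S) Pu Pv Pw (inj₂ o)    = formula³-occurs S Pu Pv Pw o
formula³-occurs (R ∪ S) Pu Pv Pw (inj₁ o)    = formula³-occurs R Pu Pv Pw o
formula³-occurs (R ∪ S) Pu Pv Pw (inj₂ o)    = formula³-occurs S Pu Pv Pw o
formula³-occurs (R ⇒ S) Pu Pv Pw (inj₁ o)    = formula³-occurs R Pu Pv Pw o
formula³-occurs (R ⇒ S) Pu Pv Pw (inj₂ o)    = formula³-occurs S Pu Pv Pw o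
formula³-occurs (R ⨾ S) Pu Pv Pw (inj₁ refl) = Pw
formula³-occurs (R ⨾ S) Pu Pv Pw (inj₂ (inj₁ o)) = formula³-occurs R Pu Pw Pv o
formula³-occurs (R ⨾ S) Pu Pv Pw (inj₂ (inj₂ o)) = formula³-occurs S Pw Pv Pu o
formula³-occurs {P} (⋂ R) Pu Pv Pw o = conjunction-occurs {P = P} Pu _ (λ i → formula³-occurs (R i) Pu Pv Pw) o
formula³-occurs {P} (⋃ R) Pu Pv Pw o = disjunction-occurs {P = P} Pu _ (λ i → formula³-occurs (R i) Pu Pv Pw) o

module _ (R : RelExpr) where

  private
    matrix : Formula graphVocabulary
    matrix = formula³ R 0 1 2

    matrix-occurs : ∀ {x} → x OccursIn matrix → x < 3
    matrix-occurs = formula³-occurs {_< 3} R (s≤s z≤n) (s≤s (s≤s z≤n)) (s≤s (s≤s (s≤s z≤n)))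

    not-free : ∀ x → ¬ (x FreeIn all′ 0 (all′ 1 (all′ 2 matrix)))
    not-free x (x≢0 , x≢1 , x≢2 , f) with matrix-occurs (FreeIn⇒OccursIn matrix f)
    ... | s≤s z≤n             = x≢0 refl
    ... | s≤s (s≤s z≤n)       = x≢1 refl
    ... | s≤s (s≤s (s≤s z≤n)) = x≢2 refl

  -- Binding the spare variable 2 as well makes closedness a consequence of the bound on occurring
  -- variables.
  universally : Sentence graphVocabulary
  universally = record
    { formula = all′ 0 (all′ 1 (all′ 2 matrix)) ; closed = not-free }

  universally-three-variable : ThreeVariable universally
  universally-three-variable _ (inj₁ refl)               = s≤s z≤n
  universally-three-variable _ (inj₂ (inj₁ refl))        = s≤s (s≤s z≤n)
  universally-three-variable _ (inj₂ (inj₂ (inj₁ refl))) = s≤s (s≤s (s≤s z≤n))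
  universally-three-variable _ (inj₂ (inj₂ (inj₂ o)))    = matrix-occurs o

  module _ (G : Structure graphVocabulary) (F : Finite G) where
    open RelSemantics (Edge G)

    ⊨-universally : G ⊨ universally ⇔ (∀ x y → (x , y) ⊩ R)
    ⊨-universally = mk⇔
      (λ G⊨ x y → to (sat _) (G⊨ (λ _ → x) x y x))
      (λ h ρ x y z → from (sat _) (h x y))
      where
      sat = Sat-formula³ G F R {0} {1} {2} (λ ()) (λ ()) (λ ())

-- Tuples of fixed length, bounds on variables and arities.

lookup-ext : {v w : Vec X n} → (∀ i → lookup v i ≡ lookup w i) → v ≡ w
lookup-ext {v = v} {w} h =
  trans (sym (tabulate∘lookup v)) (trans (tabulate-cong h) (tabulate∘lookup w))

prefix : r ≤ m → Vec X m → Vec X r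
prefix r≤m v = tabulate λ j → lookup v (inject≤ j r≤m)

lookupOr : X → Vec X n → ℕ → X
lookupOr d []      _       = d
lookupOr d (x ∷ v) zero    = x
lookupOr d (x ∷ v) (suc i) = lookupOr d v i

lookupOr-toℕ : ∀ (d : X) (v : Vec X n) i → lookupOr d v (toℕ i) ≡ lookup v i
lookupOr-toℕ d (x ∷ v) zero    = refl
lookupOr-toℕ d (x ∷ v) (suc i) = lookupOr-toℕ d v i

-- Symbols of all arities are read off tuples of one length: `prefix` takes the arguments out of a
-- tuple, `pad` completes arguments to a tuple by a default.
pad : X → Vec X r → Vec X m
pad d v = tabulate (lookupOr d v ∘ toℕ)

prefix-pad : (r≤m : r ≤ m) (d : X) (v : Vec X r) → prefix r≤m (pad d v) ≡ v
prefix-pad r≤m d v = trans (tabulate-cong entry) (tabulate∘lookup v)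
  where
  entry : ∀ j → lookup (pad d v) (inject≤ j r≤m) ≡ lookup v j
  entry j = trans (lookup∘tabulate _ (inject≤ j r≤m))
    (trans (cong (lookupOr d v) (toℕ-inject≤ j r≤m)) (lookupOr-toℕ d v j))

module Bounds {σ : Vocabulary} where

  mutual
    term-bound : (t : Term σ) → ∃ λ k → ∀ x → x ∈ᵗ t → x < k
    term-bound (var x)    = suc x , λ { _ here → ℕ.≤-refl }
    term-bound (app f ts) = let k , b = terms-bound ts in k , λ { x (there o) → b x o }

    terms-bound : (ts : Vec (Term σ) n) → ∃ λ k → ∀ x → Any (x ∈ᵗ_) ts → x < k
    terms-bound []       = 0 , λ _ ()
    terms-bound (t ∷ ts) =
      let k , b = term-bound t ; l , c = terms-bound ts
      in k ⊔ l , λ { x (here o)  → ℕ.m≤n⇒m≤n⊔o l (b x o)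
                   ; x (there o) → ℕ.m≤n⇒m≤o⊔n k (c x o) }

  formula-bound : (φ : Formula σ) → ∃ λ k → ∀ x → x OccursIn φ → x < k
  formula-bound (s ≈′ t) =
    let k , b = term-bound s ; l , c = term-bound t
    in k ⊔ l , λ x → [ ℕ.m≤n⇒m≤n⊔o l ∘ b x , ℕ.m≤n⇒m≤o⊔n k ∘ c x ]
  formula-bound (rel r ts) = terms-bound ts
  formula-bound (¬′ φ) = formula-bound φ
  formula-bound (φ ∧′ ψ) =
    let k , b = formula-bound φ ; l , c = formula-bound ψ
    in k ⊔ l , λ x → [ ℕ.m≤n⇒m≤n⊔o l ∘ b x , ℕ.m≤n⇒m≤o⊔n k ∘ c x ]
  formula-bound (φ ∨′ ψ) =
    let k , b = formula-bound φ ; l , c = formula-bound ψ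
    in k ⊔ l , λ x → [ ℕ.m≤n⇒m≤n⊔o l ∘ b x , ℕ.m≤n⇒m≤o⊔n k ∘ c x ]
  formula-bound (all′ y φ) =
    let k , b = formula-bound φ
    in suc y ⊔ k , λ x → [ (λ { refl → ℕ.m≤m⊔n (suc y) k }) , ℕ.m≤n⇒m≤o⊔n (suc y) ∘ b x ]
  formula-bound (ex′ y φ) =
    let k , b = formula-bound φ
    in suc y ⊔ k , λ x → [ (λ { refl → ℕ.m≤m⊔n (suc y) k }) , ℕ.m≤n⇒m≤o⊔n (suc y) ∘ b x ]

  values-bound : (f : Fin n → ℕ) → ∃ λ k → ∀ i → f i ≤ k
  values-bound {zero}  f = 0 , λ ()
  values-bound {suc n} f =
    let k , b = values-bound (f ∘ suc)
    in f zero ⊔ k , λ { zero → ℕ.m≤m⊔n (f zero) k ; (suc i) → ℕ.m≤n⇒m≤o⊔n (f zero) (b i) }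

-- First-order truth as a relation between tuples.

-- The dictionary by which relations on tuples describe a σ-structure: an
-- element d is represented by the tuple (d,…,d), π i leads from a tuple to its
-- i-th entry, 𝑭 f to the value of f at its leading entries.
record Dictionary (σ : Vocabulary) (K : ℕ) : Set where
  field
    Tup  : RelExpr
    π    : Fin (suc K) → RelExpr
    𝑭    : Fin (#fun σ) → RelExpr
    𝑼    : Fin (#rel σ) → RelExpr
    fun≤ : ∀ f → funArity σ f ≤ suc K
    rel≤ : ∀ r → relArity σ r ≤ suc K

  -- The choice of `ι` gives it three uses: with `punchIn i` it changes the variable i, with `id` it
  -- compares whole tuples, and with an initial segment it compares the arguments of a symbol.
  agree : (Fin n → Fin (suc K)) → RelExpr
  agree ι = Tup ∩ Tup ˘ ∩ ⋂ λ j → π (ι j) ⨾ π (ι j) ˘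

  mutual
    -- A term becomes the relation from an assignment to the element it denotes. A composite term
    -- passes through any tuple that begins with the values of its arguments; `𝑭 f` ignores the
    -- remaining entries.
    value : (t : Term σ) → (∀ x → x ∈ᵗ t → x < suc K) → RelExpr
    value (var x)    b = π (fromℕ< (b x here))
    value (app f ts) b = leading (fun≤ f) ts (λ x → b x ∘ there) ⨾ 𝑭 f

    leading : r ≤ suc K → (ts : Vec (Term σ) r) →
              (∀ x → Any (x ∈ᵗ_) ts → x < suc K) → RelExpr
    leading r≤K ts b = Tup ˘ ∩ ⋂ λ j → values ts b j ⨾ π (inject≤ j r≤K) ˘

    values : (ts : Vec (Term σ) r) →
             (∀ x → Any (x ∈ᵗ_) ts → x < suc K) → Fin r → RelExpr
    values (t ∷ ts) b zero    = value t (λ x → b x ∘ here)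
    values (t ∷ ts) b (suc j) = values ts (λ x → b x ∘ there) j

  -- A condition on the first point alone, which is why a trailing `𝟙` or `𝑼 r` frees the second.
  -- Quantifying x moves to an assignment that may differ at x only; the universal quantifier is the
  -- dual ¬∃¬ of this move.
  truth : (φ : Formula σ) → (∀ x → x OccursIn φ → x < suc K) → RelExpr
  truth (s ≈′ t) b = (value s (λ x → b x ∘ inj₁) ∩ value t (λ x → b x ∘ inj₂)) ⨾ 𝟙
  truth (rel r ts) b = leading (rel≤ r) ts b ⨾ 𝑼 r
  truth (¬′ φ) b = truth φ b ᶜ
  truth (φ ∧′ ψ) b = truth φ (λ x → b x ∘ inj₁) ∩ truth ψ (λ x → b x ∘ inj₂)
  truth (φ ∨′ ψ) b = truth φ (λ x → b x ∘ inj₁) ∪ truth ψ (λ x → b x ∘ inj₂)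
  truth (all′ x φ) b =
    (agree (punchIn (fromℕ< (b x (inj₁ refl)))) ⨾ truth φ (λ y → b y ∘ inj₂) ᶜ) ᶜ
  truth (ex′ x φ) b =
    agree (punchIn (fromℕ< (b x (inj₁ refl)))) ⨾ truth φ (λ y → b y ∘ inj₂)

module _ {σ : Vocabulary} {K : ℕ} (𝒟 : Dictionary σ K) (M : Structure σ)
         {V : Set} (edge : V → V → Set) where
  open Dictionary 𝒟
  open RelSemantics edge
  private D = Carrier M

  record _Assigns_ (a : Vec D (suc K)) (ρ : Assignment M) : Set where
    constructor assigns
    field entry : ∀ i → lookup a i ≡ ρ (toℕ i)

  -- The meeting point of both directions: the graph built from a structure and the structure
  -- extracted from a graph each provide such a representation, so one evaluation of truth serves
  -- both.
  record Represents : Set where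
    field
      tuple             : Vec D (suc K) → V
      element           : D → V
      tuple-injective   : ∀ {a b} → tuple a ≡ tuple b → a ≡ b
      element-injective : ∀ {c d} → element c ≡ element d → c ≡ d
      ⊩Tup : ∀ {x y} → (x , y) ⊩ Tup ⇔ (∃ λ a → x ≡ tuple a)
      ⊩π   : ∀ {i x y} → (x , y) ⊩ π i ⇔
             (∃ λ a → x ≡ tuple a × y ≡ element (lookup a i))
      ⊩𝑭   : ∀ {f x y} → (x , y) ⊩ 𝑭 f ⇔
             (∃ λ a → x ≡ tuple a × y ≡ element (funᴹ M f (prefix (fun≤ f) a)))
      ⊩𝑼   : ∀ {r x y} → (x , y) ⊩ 𝑼 r ⇔
             (∃ λ a → x ≡ tuple a × T (relᴹ M r (prefix (rel≤ r) a)))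

    ⊩π-tuple : ∀ {i a y} → (tuple a , y) ⊩ π i ⇔ y ≡ element (lookup a i)
    ⊩π-tuple {i} = mk⇔
      (λ p → let b , e , q = to ⊩π p in
             trans q (cong (λ c → element (lookup c i)) (sym (tuple-injective e))))
      (λ q → from ⊩π (_ , refl , q))

    ⊩𝑭-tuple : ∀ {f a y} → (tuple a , y) ⊩ 𝑭 f ⇔ y ≡ element (funᴹ M f (prefix (fun≤ f) a))
    ⊩𝑭-tuple {f} = mk⇔
      (λ p → let b , e , q = to ⊩𝑭 p in
             trans q (cong (λ c → element (funᴹ M f (prefix (fun≤ f) c))) (sym (tuple-injective e))))
      (λ q → from ⊩𝑭 (_ , refl , q))

    ⊩𝑼-tuple : ∀ {r a y} → (tuple a , y) ⊩ 𝑼 r ⇔ T (relᴹ M r (prefix (rel≤ r) a))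
    ⊩𝑼-tuple {r} = mk⇔
      (λ p → let b , e , q = to ⊩𝑼 p in
             subst (λ c → T (relᴹ M r (prefix (rel≤ r) c))) (sym (tuple-injective e)) q)
      (λ q → from ⊩𝑼 (_ , refl , q))

    ⊩agree : ∀ {ι : Fin n → Fin (suc K)} {x y} → (x , y) ⊩ agree ι ⇔
      (∃ λ a → ∃ λ b → x ≡ tuple a × y ≡ tuple b × (∀ j → lookup a (ι j) ≡ lookup b (ι j)))
    ⊩agree {ι = ι} {x} {y} = mk⇔ forth back
      where
      forth : (x , y) ⊩ agree ι → ∃ λ a → ∃ λ b →
        x ≡ tuple a × y ≡ tuple b × (∀ j → lookup a (ι j) ≡ lookup b (ι j))
      forth (p , q , h) with to ⊩Tup p | to ⊩Tup q
      ... | a , refl | b , refl = a , b , refl , refl , λ j →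
        let _ , s , t = h j
        in element-injective (trans (sym (to ⊩π-tuple s)) (to ⊩π-tuple t))
      back : (∃ λ a → ∃ λ b →
        x ≡ tuple a × y ≡ tuple b × (∀ j → lookup a (ι j) ≡ lookup b (ι j))) → (x , y) ⊩ agree ι
      back (a , b , refl , refl , h) = from ⊩Tup (a , refl) , from ⊩Tup (b , refl) ,
        λ j → _ , from ⊩π-tuple refl , from ⊩π-tuple (cong element (h j))

    assigns-< : ∀ {a ρ x} → a Assigns ρ → (x<K : x < suc K) → lookup a (fromℕ< x<K) ≡ ρ x
    assigns-< {ρ = ρ} (assigns h) x<K = trans (h (fromℕ< x<K)) (cong ρ (toℕ-fromℕ< x<K))

    mutual
      ⊩value : ∀ t b {a ρ y} → a Assigns ρ →
        (tuple a , y) ⊩ value t b ⇔ y ≡ element (⟦_⟧ M t ρ)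
      ⊩value (var x) b {a} {ρ} {y} h =
        subst (λ d → _ ⇔ y ≡ element d) (assigns-< h (b x here)) ⊩π-tuple
      ⊩value (app f ts) b {a} {ρ} {y} h = mk⇔ forth back
        where
        forth : (tuple a , y) ⊩ value (app f ts) b → y ≡ element (⟦_⟧ M (app f ts) ρ)
        forth (z , p , q) with to (⊩leading (fun≤ f) ts _ h) p
        ... | c , refl , e = trans (to ⊩𝑭-tuple q) (cong (element ∘ funᴹ M f) e)
        back : y ≡ element (⟦_⟧ M (app f ts) ρ) → (tuple a , y) ⊩ value (app f ts) b
        back refl =
          let e = prefix-pad (fun≤ f) (nonempty M) (⟦_⟧* M ts ρ)
          in _ , from (⊩leading (fun≤ f) ts _ h) (pad (nonempty M) (⟦_⟧* M ts ρ) , refl , e) ,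
             from ⊩𝑭-tuple (cong (element ∘ funᴹ M f) (sym e))

      ⊩leading : ∀ (r≤K : r ≤ suc K) (ts : Vec (Term σ) r) b {a ρ y} → a Assigns ρ →
        (tuple a , y) ⊩ leading r≤K ts b ⇔
        (∃ λ c → y ≡ tuple c × prefix r≤K c ≡ ⟦_⟧* M ts ρ)
      ⊩leading r≤K ts b {a} {ρ} {y} h = mk⇔ forth back
        where
        forth : (tuple a , y) ⊩ leading r≤K ts b → _
        forth (p , q) with to ⊩Tup p
        ... | c , refl = c , refl , trans
          (tabulate-cong λ j → let _ , s , t = q j in element-injective
            (trans (sym (to ⊩π-tuple t)) (to (⊩values ts b h j) s)))
          (tabulate∘lookup _)
        back : (∃ λ c → y ≡ tuple c × prefix r≤K c ≡ ⟦_⟧* M ts ρ) → (tuple a , y) ⊩ leading r≤K ts b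
        back (c , refl , e) = from ⊩Tup (c , refl) , λ j →
          _ , from (⊩values ts b h j) refl , from ⊩π-tuple (cong element
            (trans (cong (λ v → lookup v j) (sym e)) (lookup∘tabulate _ j)))

      ⊩values : ∀ (ts : Vec (Term σ) r) b {a ρ y} → a Assigns ρ → ∀ j →
        (tuple a , y) ⊩ values ts b j ⇔ y ≡ element (lookup (⟦_⟧* M ts ρ) j)
      ⊩values (t ∷ ts) b h zero    = ⊩value t _ h
      ⊩values (t ∷ ts) b h (suc j) = ⊩values ts _ h j

    -- A step along `agree (punchIn i)` reassigns the variable i: every other position is
    -- `punchIn i j` for some j, hence unchanged, and the new value is the entry of c at i.
    assigns-update : ∀ {a c ρ x} → a Assigns ρ → (x<K : x < suc K) →
      (∀ j → lookup a (punchIn (fromℕ< x<K) j) ≡ lookup c (punchIn (fromℕ< x<K) j)) →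
      c Assigns (_[_↦_] M ρ x (lookup c (fromℕ< x<K)))
    assigns-update {a} {c} {ρ} {x} (assigns h) x<K same = assigns entries
      where
      entries : ∀ i → lookup c i ≡ _[_↦_] M ρ x (lookup c (fromℕ< x<K)) (toℕ i)
      entries i with x ≟ toℕ i
      ... | yes refl = trans (cong (lookup c) (sym (fromℕ<-toℕ i _))) (sym (update-same M ρ x _))
      ... | no x≢i =
       let i≢ : fromℕ< x<K ≢ i
           i≢ e = x≢i (trans (sym (toℕ-fromℕ< x<K)) (cong toℕ e))
           undo = punchIn-punchOut i≢
       in trans (cong (lookup c) (sym undo)) (trans (sym (same (punchOut i≢)))
           (trans (cong (lookup a) undo)
             (trans (h i) (sym (update-other M ρ _ x≢i)))))

    module _ (F : V ↔ Fin n) (edge? : Decidable edge) where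

      ⊩truth : ∀ φ b {a ρ y} → a Assigns ρ → (tuple a , y) ⊩ truth φ b ⇔ Sat M ρ φ
      ⊩truth (s ≈′ t) b {a} {ρ} h = mk⇔
        (λ (z , (p , q) , _) → element-injective
          (trans (sym (to (⊩value s _ h) p)) (to (⊩value t _ h) q)))
        (λ e → _ , (from (⊩value s _ h) refl ,
                    from (⊩value t _ h) (cong element e)) , tt)
      ⊩truth (rel r ts) b {a} {ρ} {y} h = mk⇔ forth back
        where
        forth : (tuple a , y) ⊩ truth (rel r ts) b → Sat M ρ (rel r ts)
        forth (z , p , q) with to (⊩leading (rel≤ r) ts _ h) p
        ... | c , refl , e = subst (T ∘ relᴹ M r) e (to ⊩𝑼-tuple q)
        back : Sat M ρ (rel r ts) → (tuple a , y) ⊩ truth (rel r ts) b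
        back p =
          let e = prefix-pad (rel≤ r) (nonempty M) (⟦_⟧* M ts ρ)
          in _ , from (⊩leading (rel≤ r) ts _ h) (pad (nonempty M) (⟦_⟧* M ts ρ) , refl , e) ,
             from ⊩𝑼-tuple (subst (T ∘ relᴹ M r) (sym e) p)
      ⊩truth (¬′ φ) b h =
        let s = ⊩truth φ _ h in mk⇔ (_∘ from s) (_∘ to s)
      ⊩truth (φ ∧′ ψ) b h =
        let s = ⊩truth φ _ h ; t = ⊩truth ψ _ h
        in mk⇔ (λ (p , q) → to s p , to t q) (λ (p , q) → from s p , from t q)
      ⊩truth (φ ∨′ ψ) b h =
        let s = ⊩truth φ _ h ; t = ⊩truth ψ _ h
        in mk⇔ (Sum.map (to s) (to t)) (Sum.map (from s) (from t))
      ⊩truth (all′ x φ) b {a} {ρ} {y} h = mk⇔ forth back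
        where
        i = fromℕ< (b x (inj₁ refl))
        forth : (tuple a , y) ⊩ truth (all′ x φ) b → Sat M ρ (all′ x φ)
        forth p d = subst (λ d → Sat M (_[_↦_] M ρ x d) φ) (lookup∘update i a d)
          (to (⊩truth φ _ (assigns-update h (b x (inj₁ refl)) same))
            -- The universal quantifier was encoded as ¬∃¬; finiteness of the graph removes the
            -- double negation.
            (decidable-stable (⊩? F edge? (truth φ _) _ _)
              λ ¬q → p (_ , from ⊩agree (a , a [ i ]≔ d , refl , refl , same) , ¬q)))
          where
          same : ∀ j → lookup a (punchIn i j) ≡ lookup (a [ i ]≔ d) (punchIn i j)
          same j = sym (lookup∘update′ (punchInᵢ≢i i j) a d)
        back : Sat M ρ (all′ x φ) → (tuple a , y) ⊩ truth (all′ x φ) b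
        back s (z , p , ¬q) with to ⊩agree p
        ... | a′ , c , e , refl , same with tuple-injective e
        ... | refl = ¬q (from (⊩truth φ _ (assigns-update h (b x (inj₁ refl)) same)) (s _))
      ⊩truth (ex′ x φ) b {a} {ρ} {y} h = mk⇔ forth back
        where
        i = fromℕ< (b x (inj₁ refl))
        forth : (tuple a , y) ⊩ truth (ex′ x φ) b → Sat M ρ (ex′ x φ)
        forth (z , p , q) with to ⊩agree p
        ... | a′ , c , e , refl , same with tuple-injective e
        ... | refl = _ , to (⊩truth φ _ (assigns-update h (b x (inj₁ refl)) same)) q
        back : Sat M ρ (ex′ x φ) → (tuple a , y) ⊩ truth (ex′ x φ) b
        back (d , s) = _ , from ⊩agree (a , a [ i ]≔ d , refl , refl , same) ,
          from (⊩truth φ _ (assigns-update h (b x (inj₁ refl)) same))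
            (subst (λ d → Sat M (_[_↦_] M ρ x d) φ) (sym (lookup∘update i a d)) s)
          where
          same : ∀ j → lookup a (punchIn i j) ≡ lookup (a [ i ]≔ d) (punchIn i j)
          same j = sym (lookup∘update′ (punchInᵢ≢i i j) a d)

      -- An assignment values all variables, a tuple only the first K + 1. So an assignment is cut
      -- off in one direction, and a tuple is continued by a default value in the other.
      ⊩truth⇔⊨ : ∀ (φ : Sentence σ) b →
        (∀ x y → (x , y) ⊩ (Tup ⇒ truth (formula φ) b)) ⇔ M ⊨ φ
      ⊩truth⇔⊨ φ b = mk⇔
        (λ h ρ → to (⊩truth (formula φ) b {tabulate (ρ ∘ toℕ)} {ρ}
            (assigns (lookup∘tabulate _)))
          (h _ (tuple (tabulate (ρ ∘ toℕ))) (from ⊩Tup (_ , refl))))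
        (λ M⊨ x y p → case to ⊩Tup p of λ where
          (a , refl) → from (⊩truth (formula φ) b (assigns λ i → sym (lookupOr-toℕ (nonempty M) a i)))
            (M⊨ (lookupOr (nonempty M) a)))

-- Cardinalities of subsets and of sets of tuples.

Subset : (X → Bool) → Set
Subset {X} P = Σ X λ a → T (P a)

-- Boolean membership has unique proofs, so that counting a `Subset` counts the elements themselves.
subset-≡ : {P : X → Bool} {u v : Subset P} → proj₁ u ≡ proj₁ v → u ≡ v
subset-≡ {u = a , p} {.a , q} refl = cong (a ,_) (T-irrelevant p q)

subset-of-Fin : (P : Fin n → Bool) → ∃ λ m → Subset P ↔ Fin m
subset-of-Fin {zero}  P = 0 , mk↔ₛ′ (λ ()) (λ ()) (λ ()) (λ ())
subset-of-Fin {suc n} P =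
  let l , b = first (P zero) ; m , c = subset-of-Fin (P ∘ suc)
  in l + m , ↔-trans split (↔-trans (b ⊎-↔ c) (↔-sym +↔⊎))
  where
  first : ∀ b → ∃ λ m → T b ↔ Fin m
  first true  = 1 , mk↔ₛ′ (λ _ → zero) _ (λ { zero → refl }) (λ _ → refl)
  first false = 0 , mk↔ₛ′ (λ ()) (λ ()) (λ ()) (λ ())
  split : Subset P ↔ (T (P zero) ⊎ Subset (P ∘ suc))
  split = mk↔ₛ′ (λ { (zero , p) → inj₁ p ; (suc i , p) → inj₂ (i , p) })
                [ (zero ,_) , (λ (i , p) → suc i , p) ]
                [ (λ _ → refl) , (λ _ → refl) ]
                (λ { (zero , p) → refl ; (suc i , p) → refl })

subset-finite : X ↔ Fin n → (P : X → Bool) → ∃ λ m → Subset P ↔ Fin m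
subset-finite F P =
  let m , c = subset-of-Fin (P ∘ Inverse.from F)
  in m , ↔-trans (mk↔ₛ′
       (λ (a , p) → Inverse.to F a , subst (T ∘ P) (sym (Inverse.strictlyInverseʳ F a)) p)
       (λ (i , p) → Inverse.from F i , p)
       (λ (i , _) → subset-≡ (Inverse.strictlyInverseˡ F i))
       (λ (a , _) → subset-≡ (Inverse.strictlyInverseʳ F a))) c

Vec-finite : X ↔ Fin n → ∀ k → Vec X k ↔ Fin (n ^ k)
Vec-finite F zero    = mk↔ₛ′ (λ _ → zero) (λ _ → []) (λ { zero → refl }) (λ { [] → refl })
Vec-finite F (suc k) = ↔-trans
  (mk↔ₛ′ uncons (uncurry _∷_) (λ _ → refl) (λ { (_ ∷ _) → refl }))
  (↔-trans (F ×-↔ Vec-finite F k) (↔-sym *↔×))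

-- Strict monotonicity, the exponent and the factor being positive. This is what recovers the size
-- of a structure from that of its graph.
tuple-size-injective : ∀ K C → m ^ suc K * suc C ≡ n ^ suc K * suc C → m ≡ n
tuple-size-injective {m} {n} K C e with ℕ.*-cancelʳ-≡ (m ^ suc K) (n ^ suc K) (suc C) e | ℕ.<-cmp m n
... | e′ | tri< m<n _ _ = ⊥-elim (ℕ.<-irrefl e′ (ℕ.^-monoˡ-< (suc K) m<n))
... | e′ | tri≈ _ m≡n _ = m≡n
... | e′ | tri> _ _ n<m = ⊥-elim (ℕ.<-irrefl (sym e′) (ℕ.^-monoˡ-< (suc K) n<m))

-- Axioms for graphs that code structures.

decided : {P : Set} → Dec P → RelExpr
decided (yes _) = 𝟙
decided (no _)  = 𝟙 ᶜ

module _ {V : Set} (edge : V → V → Set) where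
  open RelSemantics edge

  -- Facts known outside the graph, such as equality or parity of positions, enter expressions as
  -- constants.
  ⊩decided : {P : Set} {d : Dec P} {x y : V} → (x , y) ⊩ decided d ⇔ P
  ⊩decided {d = yes p} = mk⇔ (λ _ → p) _
  ⊩decided {d = no ¬p} = mk⇔ (λ f → ⊥-elim (f tt)) ¬p′
    where
    ¬p′ = λ p _ → ¬p p

data Label (σ : Vocabulary) (K : ℕ) : Set where
  coordinate : Fin (suc K) → Label σ K
  function   : Fin (#fun σ) → Label σ K
  relation   : Fin (#rel σ) → Label σ K

-- Every tuple owns one vertex in each of the positions Fin (suc C): W p leads
-- from the vertex in position zero to the one in position p.  A tuple is
-- l-related to another if its vertex in position (pos l) is adjacent to the
-- vertex in position hub of the other.
record Layout (σ : Vocabulary) (K C : ℕ) : Set where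
  field
    W    : Fin (suc C) → RelExpr
    pos  : Label σ K → Fin (suc C)
    hub  : Fin (suc C)
    side : RelExpr
    fun≤ : ∀ f → funArity σ f ≤ suc K
    rel≤ : ∀ r → relArity σ r ≤ suc K

  link : Label σ K → RelExpr
  link l = W (pos l) ⨾ E ⨾ W hub ˘

  dictionary : Dictionary σ K
  dictionary = record
    { Tup  = W zero ⨾ 𝟙
    ; π    = link ∘ coordinate
    ; 𝑭    = link ∘ function
    ; 𝑼    = λ r → link (relation r) ⨾ 𝟙
    ; fun≤ = fun≤
    ; rel≤ = rel≤
    }

  open Dictionary dictionary public hiding (fun≤; rel≤)

  left : RelExpr
  left = side ⨾ 𝟙

  -- Elements are coded by constant tuples, which are the common fixed points of all projections. As
  -- an expression this is a part of the identity.
  El : RelExpr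
  El = ⋂ λ i → π i ∩ I

  initial : r ≤ suc K → Fin r → Fin (suc K)
  initial r≤K j = inject≤ j r≤K

  operation : RelExpr → RelExpr
  operation R = (Tup ⇒ R ⨾ 𝟙) ∩ (R ˘ ⨾ R ⇒ I) ∩ (R ⇒ 𝟙 ⨾ El)

module _ {K C : ℕ} (ℒ : Layout σ K C) (τ : RelExpr) where
  open Layout ℒ

  -- Since agree id is contained in the identity and any single entry of a tuple
  -- can be exchanged, the tuples are exactly the (suc K)-tuples of elements.
  axioms : RelExpr
  axioms =
    -- All finite models must be bipartite graphs, so the sentence itself has to enforce symmetry
    -- and a splitting; `left` is one of the parts.
    (E ⇒ E ˘) ∩
    (E ⇒ left ∩ left ᶜ ˘ ∪ left ᶜ ∩ left ˘) ∩
    -- These five clauses make `W` a bijection from pairs of a tuple and a position onto the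
    -- vertices, which fixes their number.
    (⋃ λ p → 𝟙 ⨾ W p) ∩
    (⋂ λ p → Tup ⇒ W p ⨾ 𝟙) ∩
    (⋂ λ p → W p ⇒ Tup) ∩
    (⋂ λ p → W p ˘ ⨾ W p ⇒ I) ∩
    (⋂ λ p → ⋂ λ p′ → W p ⨾ W p′ ˘ ⇒ I ∩ decided (p Fin.≟ p′)) ∩
    (⋂ λ i → operation (π i)) ∩
    (agree id ⇒ I) ∩
    (⋂ λ i → Tup ∩ 𝟙 ⨾ El ⇒ agree (punchIn i) ⨾ π i) ∩
    (⋂ λ f → operation (𝑭 f)) ∩
    -- Arguments can be completed to a tuple in many ways; the result must not depend on the choice.
    (⋂ λ f → agree (initial (fun≤ f)) ⨾ 𝑭 f ⇒ 𝑭 f) ∩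
    (⋂ λ r → agree (initial (rel≤ r)) ⨾ 𝑼 r ⇒ 𝑼 r) ∩
    (Tup ⇒ τ)

  module _ {V : Set} (edge : V → V → Set) where
    open RelSemantics edge

    record Axiomatic : Set where
      field
        symmetric   : ∀ x y → (x , y) ⊩ (E ⇒ E ˘)
        two-sided   : ∀ x y → (x , y) ⊩ (E ⇒ left ∩ left ᶜ ˘ ∪ left ᶜ ∩ left ˘)
        covered     : ∀ x y → (x , y) ⊩ (⋃ λ p → 𝟙 ⨾ W p)
        W-total     : ∀ p x y → (x , y) ⊩ (Tup ⇒ W p ⨾ 𝟙)
        W-domain    : ∀ p x y → (x , y) ⊩ (W p ⇒ Tup)
        W-unique    : ∀ p x y → (x , y) ⊩ (W p ˘ ⨾ W p ⇒ I)
        W-disjoint  : ∀ p p′ x y → (x , y) ⊩ (W p ⨾ W p′ ˘ ⇒ I ∩ decided (p Fin.≟ p′))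
        π-operation : ∀ i x y → (x , y) ⊩ operation (π i)
        extensional : ∀ x y → (x , y) ⊩ (agree id ⇒ I)
        exchange    : ∀ i x y → (x , y) ⊩ (Tup ∩ 𝟙 ⨾ El ⇒ agree (punchIn i) ⨾ π i)
        𝑭-operation : ∀ f x y → (x , y) ⊩ operation (𝑭 f)
        𝑭-initial   : ∀ f x y → (x , y) ⊩ (agree (initial (fun≤ f)) ⨾ 𝑭 f ⇒ 𝑭 f)
        𝑼-initial   : ∀ r x y → (x , y) ⊩ (agree (initial (rel≤ r)) ⨾ 𝑼 r ⇒ 𝑼 r)
        valid       : ∀ x y → (x , y) ⊩ (Tup ⇒ τ)

    ⊩axioms : (∀ x y → (x , y) ⊩ axioms) ⇔ Axiomatic
    ⊩axioms = mk⇔ forth back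
      where
      forth : (∀ x y → (x , y) ⊩ axioms) → Axiomatic
      forth h = record
        { symmetric   = λ x y → let a , _ = h x y in a
        ; two-sided   = λ x y → let _ , a , _ = h x y in a
        ; covered     = λ x y → let _ , _ , a , _ = h x y in a
        ; W-total     = λ p x y → let _ , _ , _ , a , _ = h x y in a p
        ; W-domain    = λ p x y → let _ , _ , _ , _ , a , _ = h x y in a p
        ; W-unique    = λ p x y → let _ , _ , _ , _ , _ , a , _ = h x y in a p
        ; W-disjoint  = λ p p′ x y → let _ , _ , _ , _ , _ , _ , a , _ = h x y in a p p′
        ; π-operation = λ i x y → let _ , _ , _ , _ , _ , _ , _ , a , _ = h x y in a i
        ; extensional = λ x y → let _ , _ , _ , _ , _ , _ , _ , _ , a , _ = h x y in a
        ; exchange    = λ i x y → let _ , _ , _ , _ , _ , _ , _ , _ , _ , a , _ = h x y in a i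
        ; 𝑭-operation = λ f x y → let _ , _ , _ , _ , _ , _ , _ , _ , _ , _ , a , _ = h x y in a f
        ; 𝑭-initial   = λ f x y → let _ , _ , _ , _ , _ , _ , _ , _ , _ , _ , _ , a , _ = h x y in a f
        ; 𝑼-initial   = λ r x y → let _ , _ , _ , _ , _ , _ , _ , _ , _ , _ , _ , _ , a , _ = h x y in a r
        ; valid       = λ x y → let _ , _ , _ , _ , _ , _ , _ , _ , _ , _ , _ , _ , _ , a = h x y in a
        }
      back : Axiomatic → ∀ x y → (x , y) ⊩ axioms
      back h x y =
        symmetric x y , two-sided x y , covered x y ,
        (λ p → W-total p x y) , (λ p → W-domain p x y) , (λ p → W-unique p x y) ,
        (λ p p′ → W-disjoint p p′ x y) , (λ i → π-operation i x y) ,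
        extensional x y , (λ i → exchange i x y) , (λ f → 𝑭-operation f x y) ,
        (λ f → 𝑭-initial f x y) , (λ r → 𝑼-initial r x y) , valid x y
        where open Axiomatic h

-- From a graph satisfying the axioms to a structure.

module Decoding {σ : Vocabulary} {K C : ℕ} (ℒ : Layout σ K C) (τ : RelExpr)
  {V : Set} {N : ℕ} (F : V ↔ Fin N) (v₀ : V)
  {edge : V → V → Set} (edge? : Decidable edge) (h : Axiomatic ℒ τ edge) where
  open Layout ℒ
  open RelSemantics edge
  open Axiomatic h

  -- A record, because R cannot be inferred from the computed type (x , y) ⊩ R.
  record _⟨_⟩_ (x : V) (R : RelExpr) (y : V) : Set where
    constructor holds
    field holding : (x , y) ⊩ R
  open _⟨_⟩_

  abstract
    holds? : ∀ R x y → Dec (x ⟨ R ⟩ y)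
    holds? R x y = map′ holds holding (⊩? F edge? R x y)

  isElement : V → Bool
  isElement v = isYes (holds? El v v)

  D : Set
  D = Subset isElement

  D-finite : ∃ λ m → D ↔ Fin m
  D-finite = subset-finite F isElement

  IsTuple : V → Set
  IsTuple x = x ⟨ Tup ⟩ x

  Operation : RelExpr → Set
  Operation R = ∀ x y → (x , y) ⊩ operation R

  abstract
    operate : ∀ {R} → Operation R → ∀ {x} → IsTuple x → ∃ λ (d : D) → x ⟨ R ⟩ proj₁ d
    operate h {x} (holds t) =
      let total , _ , _ = h x x
          d , p , _ = total t
          _ , _ , range = h x d
          z , _ , e = range p
          -- `El` lies within the identity, so the element that `range` provides is d itself.
          z≡d = proj₂ (e zero)
      in (d , fromWitness (holds (subst (λ z → (z , d) ⊩ El) z≡d e))) , holds p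

    operate-unique : ∀ {R} → Operation R → ∀ {x y z} → x ⟨ R ⟩ y → x ⟨ R ⟩ z → y ≡ z
    operate-unique h {x} {y} {z} (holds p) (holds q) =
      let _ , unique , _ = h y z in unique (x , p , q)

  Tup-any : ∀ {x y z} → x ⟨ Tup ⟩ y → x ⟨ Tup ⟩ z
  Tup-any (holds (w , p , _)) = holds (w , p , tt)

  W-tuple : ∀ {p x y} → x ⟨ W p ⟩ y → IsTuple x
  W-tuple {p} {x} {y} (holds w) = Tup-any (holds {y = y} (W-domain p x y w))

  link-tuple : ∀ {l x y} → x ⟨ link l ⟩ y → IsTuple x
  link-tuple (holds (w , p , _)) = W-tuple (holds p)

  -- Every vertex belongs to the gadget of some tuple, and a graph has a vertex. This starts the
  -- construction of all tuples and yields an element.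
  some-tuple : ∃ IsTuple
  some-tuple = let p , x , _ , w = covered v₀ v₀ in x , W-tuple {p} {y = v₀} (holds w)

  agree-intro : ∀ {n} {ι : Fin n → Fin (suc K)} {x y} → IsTuple x → IsTuple y →
    (∀ j → ∃ λ z → x ⟨ π (ι j) ⟩ z × y ⟨ π (ι j) ⟩ z) → x ⟨ agree ι ⟩ y
  agree-intro {x = x} {y} s t h = holds (holding (Tup-any {z = y} s) , holding (Tup-any {z = x} t) ,
    λ j → let z , p , q = h j in z , holding p , holding q)

  -- `exchange` supplies y. The other entries are kept because x and y have a common value there and
  -- a projection has only one value.
  change-entry : ∀ {x} → IsTuple x → ∀ i (d : D) → ∃ λ y → IsTuple y ×
    y ⟨ π i ⟩ proj₁ d × (∀ {j u} → i ≢ j → x ⟨ π j ⟩ u → y ⟨ π j ⟩ u)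
  change-entry {x} t i (d , e) =
    let y , (_ , s , common) , q = exchange i x d (holding (Tup-any {z = d} t) , d , tt , holding (toWitness e))
    in y , Tup-any (holds {y = x} s) , holds q , λ i≢j → keep common i≢j
    where
    keep : ∀ {y} → (x , y) ⊩ (⋂ λ j → π (punchIn i j) ⨾ π (punchIn i j) ˘) →
           ∀ {j u} → i ≢ j → x ⟨ π j ⟩ u → y ⟨ π j ⟩ u
    keep {y} common {j} {u} i≢j p =
      let u′ , p′ , q′ = common (punchOut i≢j)
          p″ : x ⟨ π j ⟩ u′
          p″ = subst (λ j → x ⟨ π j ⟩ u′) (punchIn-punchOut i≢j) (holds p′)
          q″ : y ⟨ π j ⟩ u′
          q″ = subst (λ j → y ⟨ π j ⟩ u′) (punchIn-punchOut i≢j) (holds q′)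
      in subst (λ u → y ⟨ π j ⟩ u) (operate-unique {π j} (π-operation j) p″ p) q″

  -- Begin with an arbitrary tuple and overwrite one entry after another, each time keeping the
  -- earlier ones.
  tuple-upto : (a : Vec D (suc K)) → ∀ k → k ≤ suc K →
    ∃ λ x → IsTuple x × (∀ i → toℕ i < k → x ⟨ π i ⟩ proj₁ (lookup a i))
  tuple-upto a zero    _   = let x , t = some-tuple in x , t , λ _ ()
  tuple-upto a (suc k) k<K with tuple-upto a k (ℕ.<⇒≤ k<K)
  ... | x , t , h with change-entry t (fromℕ< k<K) (lookup a (fromℕ< k<K))
  ... | y , s , q , kept = y , s , entry
    where
    i = fromℕ< k<K
    entry : ∀ j → toℕ j < suc k → y ⟨ π j ⟩ proj₁ (lookup a j)
    entry j j<k with i Fin.≟ j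
    ... | yes i≡j = subst (λ j → y ⟨ π j ⟩ proj₁ (lookup a j)) i≡j q
    ... | no i≢j  = kept i≢j (h j (ℕ.≤∧≢⇒< (ℕ.≤-pred j<k)
                      λ e → i≢j (toℕ-injective (trans (toℕ-fromℕ< k<K) (sym e)))))

  abstract
    tuple-of : (a : Vec D (suc K)) →
      ∃ λ x → IsTuple x × (∀ i → x ⟨ π i ⟩ proj₁ (lookup a i))
    tuple-of a = let x , t , h = tuple-upto a (suc K) ℕ.≤-refl in x , t , λ i → h i (toℕ<n i)

  tuple : Vec D (suc K) → V
  tuple = proj₁ ∘ tuple-of

  tuple-tuple : ∀ a → IsTuple (tuple a)
  tuple-tuple a = proj₁ (proj₂ (tuple-of a))

  tuple-π : ∀ a i → tuple a ⟨ π i ⟩ proj₁ (lookup a i)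
  tuple-π a = proj₂ (proj₂ (tuple-of a))

  entry : ∀ {x} → IsTuple x → Fin (suc K) → D
  entry t i = proj₁ (operate {π i} (π-operation i) t)

  entries : ∀ {x} → IsTuple x → Vec D (suc K)
  entries t = tabulate (entry t)

  tuple-entries : ∀ {x} (t : IsTuple x) → x ≡ tuple (entries t)
  tuple-entries {x} t = extensional x (tuple (entries t)) (holding
    (agree-intro {ι = id} t (tuple-tuple (entries t)) λ i → _ , π-entry i , tuple-π (entries t) i))
    where
    π-entry : ∀ i → x ⟨ π i ⟩ proj₁ (lookup (entries t) i)
    π-entry i = subst (λ d → x ⟨ π i ⟩ proj₁ d) (sym (lookup∘tabulate (entry t) i))
      (proj₂ (operate {π i} (π-operation i) t))

  tuple-injective : ∀ {a b} → tuple a ≡ tuple b → a ≡ b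
  tuple-injective {a} {b} e = lookup-ext λ i → subset-≡ (operate-unique {π i} (π-operation i)
    (tuple-π a i) (subst (λ x → x ⟨ π i ⟩ proj₁ (lookup b i)) (sym e) (tuple-π b i)))

  d₀ : D
  d₀ = proj₁ (operate {π zero} (π-operation zero) (proj₂ some-tuple))

  -- Arguments are padded to a tuple to find a vertex at which the interpretation is read off. The
  -- axioms `𝑭-initial` and `𝑼-initial` carry the result to all tuples that begin with these
  -- arguments.
  structure : Structure σ
  structure = record
    { Carrier  = D
    ; nonempty = d₀
    ; relᴹ     = λ r v → let x = tuple (pad d₀ v) in isYes (holds? (𝑼 r) x x)
    ; funᴹ     = λ f v → proj₁ (operate {𝑭 f} (𝑭-operation f) (tuple-tuple (pad d₀ v)))
    }

  module _ {r} (r≤K : r ≤ suc K) (a : Vec D (suc K)) where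

    private
      b : Vec D (suc K)
      b = pad d₀ (prefix r≤K a)

      same : ∀ j → lookup b (initial r≤K j) ≡ lookup a (initial r≤K j)
      same j = trans (sym (lookup∘tabulate (lookup b ∘ initial r≤K) j)) (trans
        (cong (λ v → lookup v j) (prefix-pad r≤K d₀ (prefix r≤K a))) (lookup∘tabulate (lookup a ∘ initial r≤K) j))

      common : ∀ j → tuple b ⟨ π (initial r≤K j) ⟩ proj₁ (lookup a (initial r≤K j))
      common j = subst (λ d → tuple b ⟨ π (initial r≤K j) ⟩ proj₁ d) (same j) (tuple-π b (initial r≤K j))

    agree-padʳ : tuple a ⟨ agree (initial r≤K) ⟩ tuple (pad d₀ (prefix r≤K a))
    agree-padʳ = agree-intro (tuple-tuple a) (tuple-tuple b) λ j →
      _ , tuple-π a (initial r≤K j) , common j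

    agree-padˡ : tuple (pad d₀ (prefix r≤K a)) ⟨ agree (initial r≤K) ⟩ tuple a
    agree-padˡ = agree-intro (tuple-tuple b) (tuple-tuple a) λ j →
      _ , common j , tuple-π a (initial r≤K j)

  ⊩𝑭-structure : ∀ f a → tuple a ⟨ 𝑭 f ⟩ proj₁ (funᴹ structure f (prefix (fun≤ f) a))
  ⊩𝑭-structure f a = holds (𝑭-initial f _ _ (_ , holding (agree-padʳ (fun≤ f) a) ,
    holding (proj₂ (operate {𝑭 f} (𝑭-operation f) (tuple-tuple (pad d₀ (prefix (fun≤ f) a)))))))

  𝑼-any : ∀ {r x y z} → x ⟨ 𝑼 r ⟩ y → x ⟨ 𝑼 r ⟩ z
  𝑼-any (holds (w , p , _)) = holds (w , p , tt)

  ⊩𝑼-structure : ∀ r a y → tuple a ⟨ 𝑼 r ⟩ y ⇔ T (relᴹ structure r (prefix (rel≤ r) a))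
  ⊩𝑼-structure r a y = mk⇔
    (λ p → fromWitness {a? = holds? (𝑼 r) x x} (holds (𝑼-initial r x x
      (tuple a , holding (agree-padˡ (rel≤ r) a) , holding (𝑼-any {z = x} p)))))
    (λ p → holds (𝑼-initial r (tuple a) y (x , holding (agree-padʳ (rel≤ r) a) ,
      holding (𝑼-any {z = y} (toWitness {a? = holds? (𝑼 r) x x} p)))))
    where x = tuple (pad d₀ (prefix (rel≤ r) a))

  operation-represented : ∀ {R} → Operation R → (g : Vec D (suc K) → D) →
    (∀ {x y} → x ⟨ R ⟩ y → IsTuple x) → (∀ a → tuple a ⟨ R ⟩ proj₁ (g a)) →
    ∀ {x y} → (x , y) ⊩ R ⇔ (∃ λ a → x ≡ tuple a × y ≡ proj₁ (g a))
  operation-represented {R} o g domain h {x} {y} = mk⇔ forth back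
    where
    forth : (x , y) ⊩ R → ∃ λ a → x ≡ tuple a × y ≡ proj₁ (g a)
    forth p =
      let t = domain (holds {y = y} p)
          a = entries t
      in a , tuple-entries t , operate-unique o (holds p)
           (subst (λ x → x ⟨ R ⟩ proj₁ (g a)) (sym (tuple-entries t)) (h a))
    back : (∃ λ a → x ≡ tuple a × y ≡ proj₁ (g a)) → (x , y) ⊩ R
    back (a , refl , refl) = holding (h a)

  represents : Represents dictionary structure edge
  represents = record
    { tuple             = tuple
    ; element           = proj₁
    ; tuple-injective   = tuple-injective
    ; element-injective = subset-≡
    ; ⊩Tup = λ {x} {y} → mk⇔
        (λ t → let t′ = Tup-any (holds {x} {_} {y} t) in entries t′ , tuple-entries t′)
        (λ { (a , refl) → holding (Tup-any {z = y} (tuple-tuple a)) })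
    ; ⊩π = λ {i} → operation-represented (π-operation i) (λ a → lookup a i)
        link-tuple (λ a → tuple-π a i)
    ; ⊩𝑭 = λ {f} → operation-represented (𝑭-operation f)
        (λ a → funᴹ structure f (prefix (fun≤ f) a)) link-tuple (⊩𝑭-structure f)
    ; ⊩𝑼 = λ {r} {x} {y} → mk⇔
        (λ (z , p , _) → let t = link-tuple {relation r} (holds {y = z} p) in
           entries t , tuple-entries t , to (⊩𝑼-structure r (entries t) y)
             (subst (λ x → x ⟨ 𝑼 r ⟩ y) (tuple-entries t) (holds (z , p , tt))))
        (λ { (a , refl , p) → holding (from (⊩𝑼-structure r a y) p) })
    }

  -- `covered` and `W-total` provide the two maps, `W-unique` and `W-disjoint` the two inverse laws.
  vertices : V ↔ (Vec D (suc K) × Fin (suc C))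
  vertices = mk↔ₛ′ address vertex address-vertex vertex-address
    where
    vertex-of : ∀ a p → ∃ λ y → tuple a ⟨ W p ⟩ y
    vertex-of a p =
      let y , w , _ = W-total p (tuple a) (tuple a) (holding (tuple-tuple a)) in y , holds w
    owner : ∀ y → ∃ λ p → ∃ λ x → x ⟨ W p ⟩ y
    owner y = let p , x , _ , w = covered y y in p , x , holds w
    address : V → Vec D (suc K) × Fin (suc C)
    address y = let p , x , w = owner y in entries (W-tuple w) , p
    vertex : Vec D (suc K) × Fin (suc C) → V
    vertex (a , p) = proj₁ (vertex-of a p)
    address-W : ∀ y → tuple (proj₁ (address y)) ⟨ W (proj₂ (address y)) ⟩ y
    address-W y = let p , x , w = owner y in
      subst (λ x → x ⟨ W p ⟩ y) (tuple-entries (W-tuple w)) w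
    vertex-address : ∀ y → vertex (address y) ≡ y
    vertex-address y = W-unique (proj₂ (address y)) _ _
      (_ , holding (proj₂ (vertex-of _ _)) , holding (address-W y))
    address-vertex : ∀ u → address (vertex u) ≡ u
    address-vertex (a , p) =
      let y = vertex (a , p)
          e , d = W-disjoint (proj₂ (address y)) p _ _
                    (y , holding (address-W y) , holding (proj₂ (vertex-of a p)))
      in cong₂ _,_ (tuple-injective e) (to (⊩decided edge {d = proj₂ (address y) Fin.≟ p}) d)

  size : ∀ {n} → V ↔ Fin (n ^ suc K * suc C) → D ↔ Fin n
  size {n} F′ =
    let m , c = D-finite
        sizes = ↔⇒≡ (↔-trans (↔-sym (↔-trans vertices
                  (↔-trans (Vec-finite c (suc K) ×-↔ ↔-refl) (↔-sym *↔×)))) F′)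
    in subst (λ m → D ↔ Fin m) (tuple-size-injective K C sizes) c

-- Definability of positions in the gadget graph.

-- The gadget of a tuple is the path 0 — 1 — ⋯ — tip.  Cross edges join the
-- positions 2, 4, …, 2 + 2L to hubs.  The ends of the paths are the leaves;
-- position 1 and the hub are the neighbours of leaves, and only the hub has two
-- further neighbours, thanks to the cross edge from position 2 of the same
-- gadget.  Away from the hubs the gadgets are disjoint paths, so all positions
-- are found by walking from the leaf 0.
module Gadget (L : ℕ) where

  -- The hub is odd because the sockets are even and cross edges must respect parity. It is 5 + 2L
  -- rather than 3 + 2L so that its predecessor on the path is no socket and the two kinds of edges
  -- at the hub stay apart.
  hub tip : ℕ
  hub = 5 + L * 2
  tip = 6 + L * 2

  -- Counting to two with three variables: `E ∩ E ⨾ I ᶜ` leads to a neighbour if there is another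
  -- one. `branching` counts in the same way the neighbours that are not leaves.
  nonLeaf leaf leafNeighbour inner branching isHub isSecond : RelExpr
  nonLeaf       = (E ∩ E ⨾ I ᶜ) ⨾ 𝟙
  leaf          = nonLeaf ᶜ
  leafNeighbour = E ⨾ leaf
  inner         = E ∩ nonLeaf ˘
  branching     = (inner ∩ inner ⨾ I ᶜ) ⨾ 𝟙
  isHub         = leafNeighbour ∩ branching
  isSecond      = leafNeighbour ∩ branching ᶜ

  -- Leads from position i back to position 0 of the same gadget. In the base case `isSecond`
  -- rejects the tip; in the step the complements reject turning round on the path and jumping to a
  -- hub along a cross edge.
  walk : ℕ → RelExpr
  walk 0             = I ∩ leaf ∩ E ⨾ isSecond
  walk 1             = isSecond ∩ E ⨾ walk 0
  walk (suc (suc i)) = E ⨾ walk (suc i) ∩ walk i ᶜ ∩ isHub ᶜ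

  toHub toTip : RelExpr
  toHub = E ⨾ walk (4 + L * 2) ∩ isHub
  toTip = E ⨾ toHub ∩ leaf

  reach : ℕ → RelExpr
  reach i with i <? hub | i ≟ hub
  ... | yes _ | _     = walk i
  ... | no _  | yes _ = toHub
  ... | no _  | no _  = toTip

  socket : Fin (suc L) → ℕ
  socket j = 2 + toℕ j * 2

  socket< : ∀ j → socket j < 4 + L * 2
  socket< j = ℕ.+-monoʳ-≤ 3 (ℕ.≤-trans (ℕ.*-monoˡ-≤ 2 (ℕ.≤-pred (toℕ<n j))) (ℕ.n≤1+n _))

  socket-injective : ∀ {i j} → socket i ≡ socket j → i ≡ j
  socket-injective {i} {j} e = toℕ-injective (ℕ.*-cancelʳ-≡ (toℕ i) (toℕ j) 2 (ℕ.+-cancelˡ-≡ 2 _ _ e))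

  4+2L<hub : 4 + L * 2 < hub
  4+2L<hub = ℕ.≤-refl

  socket≢hub : ∀ j → socket j ≢ hub
  socket≢hub j = ℕ.<⇒≢ (ℕ.<-trans (socket< j) 4+2L<hub)

  socket≢tip : ∀ j → socket j ≢ tip
  socket≢tip j = ℕ.<⇒≢ (ℕ.<-trans (ℕ.<-trans (socket< j) 4+2L<hub) ℕ.≤-refl)

  1+socket≢hub : ∀ j → suc (socket j) ≢ hub
  1+socket≢hub j e = ℕ.<⇒≢ (socket< j) (ℕ.suc-injective e)

  socket≢1+hub : ∀ j → socket j ≢ suc hub
  socket≢1+hub = socket≢tip

  -- Both directions of path edges (`up`, `down`) and of cross edges (`out`, `into`) are listed, so
  -- that symmetry is a swap of constructors. Here a and b own the gadgets, i and j are positions in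
  -- them.
  data Joined {A : Set} (R : Fin (suc L) → A → A → Set) (a : A) (i : ℕ) (b : A) (j : ℕ) : Set where
    up   : a ≡ b → j ≡ suc i → Joined R a i b j
    down : a ≡ b → i ≡ suc j → Joined R a i b j
    out  : ∀ l → i ≡ socket l → j ≡ hub → R l a b → Joined R a i b j
    into : ∀ l → j ≡ socket l → i ≡ hub → R l b a → Joined R a i b j

  module _ {A : Set} {R : Fin (suc L) → A → A → Set} where

    Joined-sym : ∀ {a i b j} → Joined R a i b j → Joined R b j a i
    Joined-sym (up e f)       = down (sym e) f
    Joined-sym (down e f)     = up (sym e) f
    Joined-sym (out l e f r)  = into l e f r
    Joined-sym (into l e f r) = out l e f r

    joined? : (∀ a b → Dec (a ≡ b)) → (∀ l a b → Dec (R l a b)) →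
              ∀ a i b j → Dec (Joined R a i b j)
    joined? _≟ᴬ_ R? a i b j = map′
      (λ { (inj₁ (e , f)) → up e f
         ; (inj₂ (inj₁ (e , f))) → down e f
         ; (inj₂ (inj₂ (inj₁ (l , e , f , r)))) → out l e f r
         ; (inj₂ (inj₂ (inj₂ (l , e , f , r)))) → into l e f r })
      (λ { (up e f)       → inj₁ (e , f)
         ; (down e f)     → inj₂ (inj₁ (e , f))
         ; (out l e f r)  → inj₂ (inj₂ (inj₁ (l , e , f , r)))
         ; (into l e f r) → inj₂ (inj₂ (inj₂ (l , e , f , r))) })
      ((a ≟ᴬ b ×-dec j ≟ suc i) ⊎-dec (a ≟ᴬ b ×-dec i ≟ suc j) ⊎-dec
       any? (λ l → i ≟ socket l ×-dec j ≟ hub ×-dec R? l a b) ⊎-dec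
       any? (λ l → j ≟ socket l ×-dec i ≟ hub ×-dec R? l b a))

  module Graph {A : Set} (R : Fin (suc L) → A → A → Set) (loop : ∀ {a b} → R zero a b ⇔ a ≡ b) where

    V : Set
    V = A × Fin (suc tip)

    own : V → A
    own = proj₁

    at : V → ℕ
    at = toℕ ∘ proj₂

    vertex-≡ : ∀ {x y} → own x ≡ own y → at x ≡ at y → x ≡ y
    vertex-≡ refl e = cong (_ ,_) (toℕ-injective e)

    at≤ : ∀ x → at x ≤ tip
    at≤ x = ℕ.≤-pred (toℕ<n (proj₂ x))

    vertex : ∀ a i → i ≤ tip → ∃ λ x → own x ≡ a × at x ≡ i
    vertex a i i≤ = (a , fromℕ< (s≤s i≤)) , refl , toℕ-fromℕ< (s≤s i≤)

    module _ {edge : V → V → Set}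
      (⊩E : ∀ {x y} → edge x y ⇔ Joined R (own x) (at x) (own y) (at y)) where
      open RelSemantics edge

      neighbour-0 : ∀ {x y} → at x ≡ 0 → edge x y → own x ≡ own y × at y ≡ 1
      neighbour-0 x≡0 e with to ⊩E e
      ... | up p q rewrite x≡0       = p , q
      ... | down p q rewrite x≡0     = case q of λ ()
      ... | out l p q r rewrite x≡0  = case p of λ ()
      ... | into l p q r rewrite x≡0 = case q of λ ()

      neighbour-tip : ∀ {x y} → at x ≡ tip → edge x y → own x ≡ own y × at y ≡ hub
      neighbour-tip {x} {y} x≡ e with to ⊩E e
      ... | up p q       = ⊥-elim (ℕ.1+n≰n (subst (_≤ tip) (trans q (cong suc x≡)) (at≤ y)))
      ... | down p q     = p , ℕ.suc-injective (trans (sym q) x≡)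
      ... | out l p q r  = ⊥-elim (socket≢tip l (trans (sym p) x≡))
      ... | into l p q r = ⊥-elim (ℕ.1+n≢n (trans (sym x≡) q))

      neighbour-1 : ∀ {x y} → at x ≡ 1 → edge x y → own x ≡ own y × (at y ≡ 0 ⊎ at y ≡ 2)
      neighbour-1 x≡1 e with to ⊩E e
      ... | up p q       = p , inj₂ (trans q (cong suc x≡1))
      ... | down p q     = p , inj₁ (ℕ.suc-injective (trans (sym q) x≡1))
      ... | out l p q r  = case trans (sym x≡1) p of λ ()
      ... | into l p q r = case trans (sym x≡1) q of λ ()

      edge-sym : ∀ {x y} → edge x y → edge y x
      edge-sym e = from ⊩E (Joined-sym (to ⊩E e))

      step-up : ∀ {x y} → own x ≡ own y → at y ≡ suc (at x) → edge x y
      step-up p q = from ⊩E (up p q)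

      predecessor : ∀ {x} → at x ≢ 0 → ∃ λ y → edge x y × own y ≡ own x × at x ≡ suc (at y)
      predecessor {x} x≢0 with at x in eq
      ... | zero  = ⊥-elim (x≢0 refl)
      ... | suc i =
        let y , p , q = vertex (own x) i (ℕ.≤-trans (ℕ.n≤1+n i) (subst (_≤ tip) eq (at≤ x)))
            e = trans eq (cong suc (sym q))
        in y , edge-sym (step-up p e) , p , cong suc (sym q)

      successor : ∀ {x} → at x ≢ tip → ∃ λ y → edge x y × own y ≡ own x × at y ≡ suc (at x)
      successor {x} x≢ =
        let y , p , q = vertex (own x) (suc (at x)) (ℕ.≤∧≢⇒< (at≤ x) x≢)
        in y , step-up (sym p) q , p , q

      nonLeaf-intro : ∀ {x y} → at x ≢ 0 → at x ≢ tip → (x , y) ⊩ nonLeaf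
      nonLeaf-intro {x} x≢0 x≢tip =
        let u , e , _ , p = predecessor {x} x≢0
            v , f , _ , q = successor {x} x≢tip
        in u , (e , v , f , λ v≡u → ℕ.m≢1+m+n (at x) (trans p (trans
             (cong (suc ∘ at) (sym v≡u)) (trans (cong suc q) (cong suc (ℕ.+-comm 1 (at x))))))) , tt

      nonLeaf-elim : ∀ {x y} → (x , y) ⊩ nonLeaf → at x ≢ 0 × at x ≢ tip
      nonLeaf-elim {x} (u , (e , v , f , v≢u) , _) =
        (λ x≡ → both neighbour-0 x≡) , (λ x≡ → both neighbour-tip x≡)
        where
        both : ∀ {i j} → (∀ {x y} → at x ≡ i → edge x y → own x ≡ own y × at y ≡ j) → at x ≢ i
        both nb x≡ =
          let p , q = nb x≡ e ; r , s = nb x≡ f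
          in v≢u (vertex-≡ (trans (sym r) p) (trans s (sym q)))

      ⊩leaf : ∀ {x y} → (x , y) ⊩ leaf ⇔ (at x ≡ 0 ⊎ at x ≡ tip)
      ⊩leaf {x} {y} = mk⇔ forth back
        where
        forth : (x , y) ⊩ leaf → at x ≡ 0 ⊎ at x ≡ tip
        forth l with at x ≟ 0 | at x ≟ tip
        ... | yes p | _     = inj₁ p
        ... | _     | yes q = inj₂ q
        ... | no p  | no q  = ⊥-elim (l (nonLeaf-intro {x} {y} p q))
        back : at x ≡ 0 ⊎ at x ≡ tip → (x , y) ⊩ leaf
        back (inj₁ p) n = proj₁ (nonLeaf-elim {x} {y} n) p
        back (inj₂ q) n = proj₂ (nonLeaf-elim {x} {y} n) q

      ⊩leafNeighbour : ∀ {x y} → (x , y) ⊩ leafNeighbour ⇔ (at x ≡ 1 ⊎ at x ≡ hub)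
      ⊩leafNeighbour {x} {y} = mk⇔ forth back
        where
        forth : (x , y) ⊩ leafNeighbour → at x ≡ 1 ⊎ at x ≡ hub
        forth (z , e , l) with to (⊩leaf {z} {y}) l
        ... | inj₁ p = inj₁ (proj₂ (neighbour-0 p (edge-sym e)))
        ... | inj₂ p = inj₂ (proj₂ (neighbour-tip p (edge-sym e)))
        back : at x ≡ 1 ⊎ at x ≡ hub → (x , y) ⊩ leafNeighbour
        back (inj₁ p) =
          let z , q , r = vertex (own x) 0 z≤n
          in z , edge-sym (step-up q (trans p (cong suc (sym r)))) , from (⊩leaf {z} {y}) (inj₁ r)
        back (inj₂ p) =
          let z , q , r = vertex (own x) tip ℕ.≤-refl
          in z , step-up (sym q) (trans r (cong suc (sym p))) , from (⊩leaf {z} {y}) (inj₂ r)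

      inner-1 : ∀ {x y} → at x ≡ 1 → (x , y) ⊩ inner → own x ≡ own y × at y ≡ 2
      inner-1 {x} {y} x≡1 (e , n) with neighbour-1 x≡1 e
      ... | p , inj₁ q = ⊥-elim (proj₁ (nonLeaf-elim {y} {x} n) q)
      ... | p , inj₂ q = p , q

      branching-1 : ∀ {x y} → at x ≡ 1 → ¬ (x , y) ⊩ branching
      branching-1 {x} x≡1 (u , (i , v , j , v≢u) , _) =
        let p , q = inner-1 {x} {u} x≡1 i ; r , s = inner-1 {x} {v} x≡1 j
        in v≢u (vertex-≡ (trans (sym r) p) (trans s (sym q)))

      branching-hub : ∀ {x y} → at x ≡ hub → (x , y) ⊩ branching
      branching-hub {x} x≡ =
        let u , p , q = vertex (own x) 2 (s≤s (s≤s z≤n))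
            v , r , s = vertex (own x) (4 + L * 2) (ℕ.≤-trans (ℕ.n≤1+n _) (ℕ.n≤1+n _))
        in u , ((from ⊩E (into zero q x≡ (from loop p)) ,
                 nonLeaf-intro {u} {x} (λ e → case trans (sym q) e of λ ()) (λ e → case trans (sym q) e of λ ())) ,
                v , (edge-sym (step-up r (trans x≡ (cong suc (sym s)))) ,
                 nonLeaf-intro {v} {x} (λ e → case trans (sym s) e of λ ())
                   (λ e → ℕ.<⇒≢ (ℕ.<-trans 4+2L<hub ℕ.≤-refl) (trans (sym s) e))) ,
                λ v≡u → case trans (sym s) (trans (cong at v≡u) q) of λ ()) , tt

      ⊩isHub : ∀ {x y} → (x , y) ⊩ isHub ⇔ at x ≡ hub
      ⊩isHub {x} {y} = mk⇔ forth
        (λ p → from (⊩leafNeighbour {x} {y}) (inj₂ p) , branching-hub {x} {y} p)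
        where
        forth : (x , y) ⊩ isHub → at x ≡ hub
        forth (l , b) with to (⊩leafNeighbour {x} {y}) l
        ... | inj₁ p = ⊥-elim (branching-1 {x} {y} p b)
        ... | inj₂ p = p

      ⊩isSecond : ∀ {x y} → (x , y) ⊩ isSecond ⇔ at x ≡ 1
      ⊩isSecond {x} {y} = mk⇔ forth
        (λ p → from (⊩leafNeighbour {x} {y}) (inj₁ p) , branching-1 {x} {y} p)
        where
        forth : (x , y) ⊩ isSecond → at x ≡ 1
        forth (l , ¬b) with to (⊩leafNeighbour {x} {y}) l
        ... | inj₁ p = p
        ... | inj₂ p = ⊥-elim (¬b (branching-hub {x} {y} p))

      Reaches : ℕ → V → V → Set
      Reaches i x y = own x ≡ own y × at x ≡ i × at y ≡ 0

      Walks : ℕ → Set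
      Walks i = ∀ {x y} → (x , y) ⊩ walk i ⇔ Reaches i x y

      -- Of the four ways to be adjacent to position i + 1, `up` would put x at position i, which
      -- `walk i` excludes; `out` would make i + 1 the hub; `into` would make x a hub. Only the path
      -- edge from position i + 2 remains.
      walk-step : ∀ i → suc (suc i) < hub → Walks i → Walks (suc i) → Walks (suc (suc i))
      walk-step i i+2<hub ⊩i ⊩i+1 {x} {y} = mk⇔ forth back
        where
        i+1<hub = ℕ.<-trans (ℕ.n<1+n (suc i)) i+2<hub
        forth : (x , y) ⊩ walk (suc (suc i)) → Reaches (suc (suc i)) x y
        forth ((z , e , w) , ¬w , ¬h) with to (⊩i+1 {z} {y}) w | to ⊩E e
        ... | o , p , q | up a b = ⊥-elim (¬w (from (⊩i {x} {y})
                (trans a o , ℕ.suc-injective (trans (sym b) p) , q)))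
        ... | o , p , q | down a b      = trans a o , trans b (cong suc p) , q
        ... | o , p , q | out l a b r   = ⊥-elim (ℕ.<⇒≢ i+1<hub (trans (sym p) b))
        ... | o , p , q | into l a b r  = ⊥-elim (¬h (from (⊩isHub {x} {y}) b))
        back : Reaches (suc (suc i)) x y → (x , y) ⊩ walk (suc (suc i))
        back (o , p , q) =
          let z , r , s = vertex (own x) (suc i) (ℕ.≤-trans (ℕ.<⇒≤ i+1<hub) (ℕ.n≤1+n _))
          in (z , edge-sym (step-up r (trans p (cong suc (sym s)))) ,
              from (⊩i+1 {z} {y}) (trans r o , s , q)) ,
             (λ w → ℕ.m≢1+m+n i (trans (sym (proj₁ (proj₂ (to (⊩i {x} {y}) w))))
                (trans p (cong suc (ℕ.+-comm 1 i))))) ,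
             (λ h → ℕ.<⇒≢ i+2<hub (trans (sym p) (to (⊩isHub {x} {y}) h)))

      ⊩walk : ∀ i → i < hub → Walks i
      ⊩walk 0 _ {x} {y} = mk⇔ forth back
        where
        forth : (x , y) ⊩ walk 0 → Reaches 0 x y
        forth (refl , l , z , e , s) with to (⊩leaf {x} {x}) l
        ... | inj₁ p = refl , p , p
        -- The tip is a leaf too, but its only neighbour is the hub and not position 1.
        ... | inj₂ p = case trans (sym (to (⊩isSecond {z} {x}) s)) (proj₂ (neighbour-tip p e)) of λ ()
        back : Reaches 0 x y → (x , y) ⊩ walk 0
        back (o , p , q) with vertex-≡ {x} {y} o (trans p (sym q)) | vertex (own x) 1 (s≤s z≤n)
        ... | refl | z , r , s = refl , from (⊩leaf {x} {x}) (inj₁ p) ,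
          z , step-up (sym r) (trans s (cong suc (sym p))) , from (⊩isSecond {z} {x}) s
      ⊩walk 1 1<hub {x} {y} = mk⇔ forth back
        where
        forth : (x , y) ⊩ walk 1 → Reaches 1 x y
        forth (s , z , e , w) =
          let o , p , q = to (⊩walk 0 (s≤s z≤n) {z} {y}) w
          in trans (sym (proj₁ (neighbour-0 p (edge-sym e)))) o , to (⊩isSecond {x} {y}) s , q
        back : Reaches 1 x y → (x , y) ⊩ walk 1
        back (o , p , q) = from (⊩isSecond {x} {y}) p ,
          y , edge-sym (step-up (sym o) (trans p (cong suc (sym q)))) ,
          from (⊩walk 0 (s≤s z≤n) {y} {y}) (refl , q , q)
      ⊩walk (suc (suc i)) i+2<hub =
        let i+1<hub = ℕ.<-trans (ℕ.n<1+n (suc i)) i+2<hub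
        in walk-step i i+2<hub (⊩walk i (ℕ.<-trans (ℕ.n<1+n i) i+1<hub)) (⊩walk (suc i) i+1<hub)

      ⊩toHub : ∀ {x y} → (x , y) ⊩ toHub ⇔ Reaches hub x y
      ⊩toHub {x} {y} = mk⇔ forth back
        where
        forth : (x , y) ⊩ toHub → Reaches hub x y
        forth ((z , e , w) , h) with to (⊩walk (4 + L * 2) 4+2L<hub {z} {y}) w | to (⊩isHub {x} {y}) h | to ⊩E e
        ... | o , p , q | x≡ | up a b       = trans a o , x≡ , q
        ... | o , p , q | x≡ | down a b     = trans a o , x≡ , q
        ... | o , p , q | x≡ | out l a b r  = ⊥-elim (socket≢hub l (trans (sym a) x≡))
        ... | o , p , q | x≡ | into l a b r = ⊥-elim (ℕ.<⇒≢ (socket< l) (trans (sym a) p))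
        back : Reaches hub x y → (x , y) ⊩ toHub
        back (o , p , q) =
          let z , r , s = vertex (own x) (4 + L * 2) (ℕ.≤-trans (ℕ.n≤1+n _) (ℕ.n≤1+n _))
          in (z , edge-sym (step-up r (trans p (cong suc (sym s)))) ,
              from (⊩walk (4 + L * 2) 4+2L<hub {z} {y}) (trans r o , s , q)) ,
             from (⊩isHub {x} {y}) p

      ⊩toTip : ∀ {x y} → (x , y) ⊩ toTip ⇔ Reaches tip x y
      ⊩toTip {x} {y} = mk⇔ forth back
        where
        forth : (x , y) ⊩ toTip → Reaches tip x y
        forth ((z , e , w) , l) with to (⊩toHub {z} {y}) w | to (⊩leaf {x} {y}) l
        ... | o , p , q | inj₂ x≡ = trans (proj₁ (neighbour-tip x≡ e)) o , x≡ , q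
        ... | o , p , q | inj₁ x≡ = case trans (sym p) (proj₂ (neighbour-0 x≡ e)) of λ ()
        back : Reaches tip x y → (x , y) ⊩ toTip
        back (o , p , q) =
          let z , r , s = vertex (own x) hub (ℕ.n≤1+n _)
          in (z , edge-sym (step-up r (trans p (cong suc (sym s)))) ,
              from (⊩toHub {z} {y}) (trans r o , s , q)) ,
             from (⊩leaf {x} {y}) (inj₂ p)

      ⊩reach : ∀ i → i ≤ tip → ∀ {x y} → (x , y) ⊩ reach i ⇔ Reaches i x y
      ⊩reach i i≤tip {x} {y} with i <? hub | i ≟ hub
      ... | yes i<hub | _        = ⊩walk i i<hub {x} {y}
      ... | no _      | yes refl = ⊩toHub {x} {y}
      ... | no i≮hub  | no i≢hub =
        subst (λ i → _ ⇔ Reaches i x y) (sym (ℕ.≤-antisym i≤tip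
          (ℕ.≤∧≢⇒< (ℕ.≮⇒≥ i≮hub) (≢-sym i≢hub)))) (⊩toTip {x} {y})

-- From a structure to a bipartite graph.

odd : ℕ → Bool
odd zero    = false
odd (suc n) = not (odd n)

odd-*2 : ∀ n → odd (n * 2) ≡ false
odd-*2 zero    = refl
odd-*2 (suc n) = cong (not ∘ not) (odd-*2 n)

module Encoding {σ : Vocabulary} {K : ℕ}
  (fun≤ : ∀ f → funArity σ f ≤ suc K) (rel≤ : ∀ r → relArity σ r ≤ suc K) where

  -- One socket for each label. Socket 0 comes on top and joins every gadget to its own hub, hence
  -- the shift to `suc (index l)` below.
  L : ℕ
  L = suc K + (#fun σ + #rel σ)

  open Gadget L

  index : Label σ K → Fin L
  index (coordinate i) = i ↑ˡ (#fun σ + #rel σ)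
  index (function f)   = suc K ↑ʳ (f ↑ˡ #rel σ)
  index (relation r)   = suc K ↑ʳ (#fun σ ↑ʳ r)

  label : Fin L → Label σ K
  label j = [ coordinate , [ function , relation ] ∘ splitAt (#fun σ) ] (splitAt (suc K) j)

  label-index : ∀ l → label (index l) ≡ l
  label-index (coordinate i) rewrite splitAt-↑ˡ (suc K) i (#fun σ + #rel σ) = refl
  label-index (function f)
    rewrite splitAt-↑ʳ (suc K) (#fun σ + #rel σ) (f ↑ˡ #rel σ) | splitAt-↑ˡ (#fun σ) f (#rel σ) = refl
  label-index (relation r)
    rewrite splitAt-↑ʳ (suc K) (#fun σ + #rel σ) (#fun σ ↑ʳ r) | splitAt-↑ʳ (#fun σ) (#rel σ) r = refl

  socket<tip : ∀ j → socket j < suc tip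
  socket<tip j = ℕ.≤-trans (socket< j) (ℕ.m≤n+m _ 3)

  abstract
    from-start : Fin (suc tip) → RelExpr
    from-start p = reach (toℕ p) ˘

    label-position : Label σ K → Fin (suc tip)
    label-position l = fromℕ< (socket<tip (suc (index l)))

    at-label : ∀ l → toℕ (label-position l) ≡ socket (suc (index l))
    at-label l = toℕ-fromℕ< (socket<tip (suc (index l)))

    hub-position : Fin (suc tip)
    hub-position = fromℕ< {hub} (s≤s (ℕ.n≤1+n hub))

    at-hub : toℕ hub-position ≡ hub
    at-hub = toℕ-fromℕ< {hub} (s≤s (ℕ.n≤1+n hub))

  layout : Layout σ K tip
  layout = record
    { W    = from-start
    ; pos  = label-position
    ; hub  = hub-position
    -- The odd positions: parity is decided outside the graph, and `from-start p ˘ ⨾ 𝟙` expresses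
    -- being in position p.
    ; side = ⋃ λ p → decided (T? (odd (toℕ p))) ∩ from-start p ˘ ⨾ 𝟙
    ; fun≤ = fun≤
    ; rel≤ = rel≤
    }

  open Layout layout hiding (hub; fun≤; rel≤)

  module _ (M : Structure σ) (F : Carrier M ↔ Fin n) where

    private
      D = Carrier M
      A = Vec D (suc K)

    -- Values are represented by constant tuples. A relation symbol has no value, so its truth at a
    -- tuple is recorded by a cross edge to the hub of the same tuple.
    Related : Label σ K → A → A → Set
    Related (coordinate i) a b = b ≡ replicate (suc K) (lookup a i)
    Related (function f)   a b = b ≡ replicate (suc K) (funᴹ M f (prefix (fun≤ f) a))
    Related (relation r)   a b = a ≡ b × T (relᴹ M r (prefix (rel≤ r) a))

    R : Fin (suc L) → A → A → Set
    R zero    a b = a ≡ b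
    R (suc j) a b = Related (label j) a b

    _≟ᴬ_ : (a b : A) → Dec (a ≡ b)
    _≟ᴬ_ = ≡-dec (finite-≟ F)

    R? : ∀ j a b → Dec (R j a b)
    R? zero    a b = a ≟ᴬ b
    R? (suc j) a b with label j
    ... | coordinate i = b ≟ᴬ _
    ... | function f   = b ≟ᴬ _
    ... | relation r   = a ≟ᴬ b ×-dec T? _

    open Graph R (mk⇔ id id)

    graph : Structure graphVocabulary
    graph = record
      { Carrier  = V
      ; nonempty = replicate (suc K) (nonempty M) , zero
      ; relᴹ     = λ { _ (x ∷ y ∷ []) → isYes (joined? _≟ᴬ_ R? (own x) (at x) (own y) (at y)) }
      ; funᴹ     = λ ()
      }

    graph-size : HasCardinality graph (n ^ suc K * suc tip)
    graph-size = ↔-trans (Vec-finite F (suc K) ×-↔ ↔-refl) (↔-sym *↔×)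

    ⊩E : ∀ {x y} → Edge graph x y ⇔ Joined R (own x) (at x) (own y) (at y)
    ⊩E {x} {y} = mk⇔ (toWitness {a? = d}) (fromWitness {a? = d})
      where d = joined? _≟ᴬ_ R? (own x) (at x) (own y) (at y)

    open RelSemantics (Edge graph)

    abstract
      ⊩W : ∀ {p x y} → (x , y) ⊩ W p ⇔ (own y ≡ own x × at y ≡ toℕ p × at x ≡ 0)
      ⊩W {p} {x} {y} = ⊩reach ⊩E (toℕ p) (ℕ.≤-pred (toℕ<n p)) {y} {x}

    -- The hub is neither a socket nor next to one on the path, so an edge from a socket to a hub is
    -- a cross edge, and injectivity of `socket` tells its label.
    ⊩link : ∀ l {x y} → (x , y) ⊩ link l ⇔ (at x ≡ 0 × at y ≡ 0 × Related l (own x) (own y))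
    ⊩link l {x} {y} = mk⇔ forth back
      where
      forth : (x , y) ⊩ link l → at x ≡ 0 × at y ≡ 0 × Related l (own x) (own y)
      forth (u , w , v , e , w′)
        with to (⊩W {pos l} {x} {u}) w | to (⊩W {hub-position} {y} {v}) w′ | to ⊩E e
      ... | refl , p , q | refl , r , s | up a b =
        ⊥-elim (1+socket≢hub (suc (index l)) (trans (cong suc (sym (trans p (at-label l))))
          (trans (sym b) (trans r at-hub))))
      ... | refl , p , q | refl , r , s | down a b =
        ⊥-elim (socket≢1+hub (suc (index l)) (trans (sym (trans p (at-label l)))
          (trans b (cong suc (trans r at-hub)))))
      ... | refl , p , q | refl , r , s | into j a b c =
        ⊥-elim (socket≢hub (suc (index l)) (trans (sym (trans p (at-label l))) b))
      ... | refl , p , q | refl , r , s | out j a b c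
        with socket-injective {suc (index l)} {j} (trans (sym (trans p (at-label l))) a)
      ... | refl = q , s , subst (λ l → Related l (own x) (own y)) (label-index l) c
      back : at x ≡ 0 × at y ≡ 0 × Related l (own x) (own y) → (x , y) ⊩ link l
      back (p , q , r) =
        let u = own x , pos l ; v = own y , hub-position
        in u , from (⊩W {pos l} {x} {u}) (refl , refl , p) ,
           v , from ⊩E (out (suc (index l)) (at-label l) at-hub
                 (subst (λ l → Related l (own x) (own y)) (sym (label-index l)) r)) ,
           from (⊩W {hub-position} {y} {v}) (refl , refl , q)

    tuple : A → V
    tuple a = a , zero

    element : D → V
    element d = tuple (replicate (suc K) d)

    at-0 : ∀ {x} → at x ≡ 0 → x ≡ tuple (own x)
    at-0 p = vertex-≡ refl p

    operation-related : ∀ l (g : A → D) → (∀ {a b} → Related l a b ⇔ b ≡ replicate (suc K) (g a)) →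
      ∀ {x y} → (x , y) ⊩ link l ⇔ (∃ λ a → x ≡ tuple a × y ≡ element (g a))
    operation-related l g r {x} {y} = mk⇔ forth back
      where
      forth : (x , y) ⊩ link l → ∃ λ a → x ≡ tuple a × y ≡ element (g a)
      forth p = let q , s , t = to (⊩link l {x} {y}) p in own x , at-0 q , vertex-≡ (to r t) s
      back : (∃ λ a → x ≡ tuple a × y ≡ element (g a)) → (x , y) ⊩ link l
      back (a , refl , refl) = from (⊩link l {x} {y}) (refl , refl , from r refl)

    represents : Represents dictionary M (Edge graph)
    represents = record
      { tuple             = tuple
      ; element           = element
      ; tuple-injective   = cong proj₁
      ; element-injective = λ e → cong (λ x → lookup (proj₁ x) zero) e
      ; ⊩Tup = λ {x} {y} → mk⇔
          (λ (z , w , _) → own x , at-0 (proj₂ (proj₂ (to (⊩W {zero} {x} {z}) w))))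
          (λ { (a , refl) → x , from (⊩W {zero} {x} {x}) (refl , refl , refl) , tt })
      ; ⊩π = λ {i} → operation-related (coordinate i) (λ a → lookup a i) (mk⇔ id id)
      ; ⊩𝑭 = λ {f} → operation-related (function f) (λ a → funᴹ M f (prefix (fun≤ f) a)) (mk⇔ id id)
      ; ⊩𝑼 = λ {r} {x} {y} → mk⇔
          (λ (z , p , _) → let q , _ , _ , t = to (⊩link (relation r) {x} {z}) p in
             own x , at-0 q , t)
          (λ { (a , refl , t) → x , from (⊩link (relation r) {x} {x}) (refl , refl , refl , t) , tt })
      }

    open Represents represents using (⊩Tup; ⊩π; ⊩𝑭; ⊩𝑼; ⊩agree; ⊩π-tuple; ⊩𝑭-tuple; ⊩𝑼-tuple)

    ⊩left : ∀ {x y} → (x , y) ⊩ left ⇔ T (odd (at x))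
    ⊩left {x} {y} = mk⇔ forth back
      where
      forth : (x , y) ⊩ left → T (odd (at x))
      forth (z , (p , d , u , w , _) , _) =
        subst (T ∘ odd) (sym (proj₁ (proj₂ (to (⊩W {p} {u} {x}) w))))
          (to (⊩decided (Edge graph) {d = T? (odd (toℕ p))} {x} {z}) d)
      back : T (odd (at x)) → (x , y) ⊩ left
      back t = x , (proj₂ x , from (⊩decided (Edge graph) {d = T? (odd (at x))} {x} {x}) t ,
        tuple (own x) , from (⊩W {proj₂ x} {tuple (own x)} {x}) (refl , refl , refl) , tt) , tt

    -- A path edge changes the position by one, and a cross edge joins an even socket to the odd
    -- hub.
    odd-joined : ∀ {x y} → Joined R (own x) (at x) (own y) (at y) → odd (at y) ≡ not (odd (at x))
    odd-joined (up _ p) = cong odd p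
    odd-joined {x} {y} (down _ p) rewrite p = sym (not-involutive (odd (at y)))
    odd-joined (out l p q _) rewrite p | q | odd-*2 (toℕ l) | odd-*2 L = refl
    odd-joined (into l p q _) rewrite p | q | odd-*2 (toℕ l) | odd-*2 L = refl

    module _ (φ : Sentence σ) (bound : ∀ x → x OccursIn formula φ → x < suc K) (M⊨φ : M ⊨ φ) where

      private
        τ = truth (formula φ) bound

      ⊩El-element : ∀ d {x} → (x , element d) ⊩ (𝟙 ⨾ El)
      ⊩El-element d = element d , tt , λ i →
        from ⊩π-tuple (cong element (sym (lookup-replicate i d))) , refl

      ⊩El : ∀ {x y} → (x , y) ⊩ El → ∃ λ d → y ≡ element d
      ⊩El e = let a , _ , p = to (⊩π {zero}) (proj₁ (e zero)) in _ , p

      ⊩operation : ∀ {R} (g : A → D) →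
        (∀ {x y} → (x , y) ⊩ R ⇔ (∃ λ a → x ≡ tuple a × y ≡ element (g a))) →
        ∀ x y → (x , y) ⊩ operation R
      ⊩operation {R} g r x y = total , unique , range
        where
        total : (x , y) ⊩ (Tup ⇒ R ⨾ 𝟙)
        total t = let a , p = to (⊩Tup {x} {y}) t in _ , from r (a , p , refl) , tt
        unique : (x , y) ⊩ (R ˘ ⨾ R ⇒ I)
        unique (z , p , q) with to r p | to r q
        ... | a , refl , s | .a , refl , t = trans s (sym t)
        range : (x , y) ⊩ (R ⇒ 𝟙 ⨾ El)
        range p = let a , _ , y≡ = to r p in
          subst (λ y → (x , y) ⊩ (𝟙 ⨾ El)) (sym y≡) (⊩El-element (g a) {x})

      initial-prefix : ∀ {r} (r≤K : r ≤ suc K) {a b : A} →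
        (∀ j → lookup a (initial r≤K j) ≡ lookup b (initial r≤K j)) → prefix r≤K b ≡ prefix r≤K a
      initial-prefix r≤K h = tabulate-cong (sym ∘ h)

      axiomatic : Axiomatic layout τ (Edge graph)
      axiomatic = record
        { symmetric   = λ x y → edge-sym ⊩E
        ; two-sided   = two-sided
        ; covered     = λ x y → proj₂ y , tuple (own y) , tt ,
            from (⊩W {proj₂ y} {tuple (own y)} {y}) (refl , refl , refl)
        ; W-total     = λ p x y t → case to (⊩Tup {x} {y}) t of λ where
            (a , refl) → (a , p) , from (⊩W {p} {tuple a} {a , p}) (refl , refl , refl) , tt
        ; W-domain    = λ p x y w → let _ , _ , q = to (⊩W {p} {x} {y}) w in
            from (⊩Tup {x} {y}) (own x , at-0 q)
        ; W-unique    = λ p x y (z , w , w′) →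
            let a , b , _ = to (⊩W {p} {z} {x}) w ; c , d , _ = to (⊩W {p} {z} {y}) w′
            in vertex-≡ (trans a (sym c)) (trans b (sym d))
        ; W-disjoint  = λ p p′ x y (z , w , w′) →
            let a , b , c = to (⊩W {p} {x} {z}) w ; d , e , f = to (⊩W {p′} {y} {z}) w′
            in vertex-≡ (trans (sym a) d) (trans c (sym f)) ,
               from (⊩decided (Edge graph) {d = p Fin.≟ p′} {x} {y}) (toℕ-injective (trans (sym b) e))
        ; π-operation = λ i → ⊩operation {π i} (λ a → lookup a i) (⊩π {i})
        ; extensional = λ x y p → case to (⊩agree {ι = id} {x} {y}) p of λ where
            (a , b , refl , refl , h) → cong tuple (lookup-ext h)
        ; exchange    = exchange
        ; 𝑭-operation = λ f → ⊩operation {𝑭 f} (λ a → funᴹ M f (prefix (fun≤ f) a)) (⊩𝑭 {f})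
        ; 𝑭-initial   = 𝑭-initial
        ; 𝑼-initial   = 𝑼-initial
        ; valid       = from (⊩truth⇔⊨ graph-size (Edge? graph) φ bound) M⊨φ
        }
        where
        open Represents represents using (⊩truth⇔⊨)
        two-sided : ∀ x y → (x , y) ⊩ (E ⇒ left ∩ left ᶜ ˘ ∪ left ᶜ ∩ left ˘)
        two-sided x y e = by-parity (odd (at x)) refl (odd-joined {x} {y} (to ⊩E e))
          where
          by-parity : ∀ b → odd (at x) ≡ b → odd (at y) ≡ not (odd (at x)) →
            (x , y) ⊩ (left ∩ left ᶜ ˘ ∪ left ᶜ ∩ left ˘)
          by-parity true  p q = inj₁ (from (⊩left {x} {y}) (subst T (sym p) tt) ,
            λ l → subst T (trans q (cong not p)) (to (⊩left {y} {x}) l))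
          by-parity false p q = inj₂ ((λ l → subst T p (to (⊩left {x} {y}) l)) ,
            from (⊩left {y} {x}) (subst T (sym (trans q (cong not p))) tt))
        exchange : ∀ i x y → (x , y) ⊩ (Tup ∩ 𝟙 ⨾ El ⇒ agree (punchIn i) ⨾ π i)
        exchange i x y (t , z , _ , e) = change (to (⊩Tup {x} {y}) t) (⊩El {z} {y} e)
          where
          change : (∃ λ a → x ≡ tuple a) → (∃ λ d → y ≡ element d) → (x , y) ⊩ (agree (punchIn i) ⨾ π i)
          change (a , x≡) (d , y≡) =
            let b = a [ i ]≔ d
            in tuple b ,
               from (⊩agree {ι = punchIn i} {x} {tuple b})
                 (a , b , x≡ , refl , λ j → sym (lookup∘update′ (punchInᵢ≢i i j) a d)) ,
               from (⊩π {i} {tuple b} {y}) (b , refl , trans y≡ (cong element (sym (lookup∘update i a d))))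
        𝑭-initial : ∀ f x y → (x , y) ⊩ (agree (initial (fun≤ f)) ⨾ 𝑭 f ⇒ 𝑭 f)
        𝑭-initial f x y (z , p , q) =
          let a , b , x≡ , z≡ , h = to (⊩agree {ι = initial (fun≤ f)} {x} {z}) p
              q′ = to (⊩𝑭-tuple {f} {b} {y}) (subst (λ z → (z , y) ⊩ 𝑭 f) z≡ q)
          in from (⊩𝑭 {f} {x} {y})
               (a , x≡ , trans q′ (cong (element ∘ funᴹ M f) (initial-prefix (fun≤ f) {a} {b} h)))
        𝑼-initial : ∀ r x y → (x , y) ⊩ (agree (initial (rel≤ r)) ⨾ 𝑼 r ⇒ 𝑼 r)
        𝑼-initial r x y (z , p , q) =
          let a , b , x≡ , z≡ , h = to (⊩agree {ι = initial (rel≤ r)} {x} {z}) p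
              q′ = to (⊩𝑼-tuple {r} {b} {y}) (subst (λ z → (z , y) ⊩ 𝑼 r) z≡ q)
          in from (⊩𝑼 {r} {x} {y})
               (a , x≡ , subst (T ∘ relᴹ M r) (initial-prefix (rel≤ r) {a} {b} h) q′)

-- Reduction of arbitrary sentences to graph sentences.

record GraphReduction {σ : Vocabulary} (φ : Sentence σ) : Set₁ where
  field
    K C            : ℕ
    sentence       : Sentence graphVocabulary
    three-variable : ThreeVariable sentence
    bipartite      : FiniteModelsAreBipartiteGraphs sentence
    spec           : ∀ n → Spec φ n ⇔ Spec sentence (n ^ suc K * suc C)

abstract
  graph-reduction : {σ : Vocabulary} (φ : Sentence σ) → GraphReduction φ
  graph-reduction {σ} φ = record
    { K              = K
    ; C              = _
    ; sentence       = universally ax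
    ; three-variable = universally-three-variable ax
    ; bipartite      = λ G F G⊨ →
        let open Axiomatic (axiomatic-in G F G⊨)
            open RelSemantics (Edge G)
            -- Whether (x , y) satisfies `left` depends on x only; it is tested on the diagonal to
            -- obtain a Boolean side.
            left? = λ x → ⊩? (proj₂ F) (Edge? G) left x x
            left-any : ∀ x y z → (x , y) ⊩ left → (x , z) ⊩ left
            left-any = λ _ _ _ (w , s , _) → w , s , tt
        in (λ {x} {y} → symmetric x y) , (λ x → isYes (left? x)) , λ x y e eq →
           case two-sided x y e of λ where
             (inj₁ (p , ¬q)) → ¬q (left-any y y x
               (toWitness {a? = left? y} (subst T eq (fromWitness {a? = left? x} (left-any x y x p)))))
             (inj₂ (¬p , q)) → ¬p (left-any x x y
               (toWitness {a? = left? x} (subst T (sym eq) (fromWitness {a? = left? y} (left-any y x y q)))))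
    ; spec           = λ n → mk⇔
        (λ (M , F , M⊨φ) → graph M F , graph-size M F ,
          from (⊨-universally ax (graph M F) (_ , graph-size M F))
            (from (⊩axioms layout τ (Edge (graph M F))) (axiomatic M F φ bound M⊨φ)))
        (λ (G , F , G⊨) →
          let open Decoding layout τ F (nonempty G) (Edge? G) (axiomatic-in G (_ , F) G⊨)
                using (structure; size; represents)
              open Axiomatic (axiomatic-in G (_ , F) G⊨)
              open Represents represents
          in structure , size F , to (⊩truth⇔⊨ F (Edge? G) φ bound) valid)
    }
    where
    open Bounds {σ}
    kφ kf kr K : ℕ
    kφ = proj₁ (formula-bound (formula φ))
    kf = proj₁ (values-bound (funArity σ))
    kr = proj₁ (values-bound (relArity σ))
    -- Tuples of length K + 1 have room for every variable of φ and every argument list; the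
    -- successor keeps the length positive.
    K = kφ ⊔ (kf ⊔ kr)
    bound : ∀ x → x OccursIn formula φ → x < suc K
    bound x o = ℕ.≤-trans (proj₂ (formula-bound (formula φ)) x o)
      (ℕ.≤-trans (ℕ.m≤m⊔n kφ (kf ⊔ kr)) (ℕ.n≤1+n K))
    fun≤ : ∀ f → funArity σ f ≤ suc K
    fun≤ f = ℕ.≤-trans (proj₂ (values-bound (funArity σ)) f)
      (ℕ.≤-trans (ℕ.m≤n⇒m≤o⊔n kφ (ℕ.m≤m⊔n kf kr)) (ℕ.n≤1+n K))
    rel≤ : ∀ r → relArity σ r ≤ suc K
    rel≤ r = ℕ.≤-trans (proj₂ (values-bound (relArity σ)) r)
      (ℕ.≤-trans (ℕ.m≤n⇒m≤o⊔n kφ (ℕ.m≤n⊔m kf kr)) (ℕ.n≤1+n K))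
    open Encoding {σ} {K} fun≤ rel≤ using (layout; graph; graph-size; axiomatic)
    open Layout layout using (left; truth)
    τ ax : RelExpr
    τ = truth (formula φ) bound
    ax = axioms layout τ
    axiomatic-in : ∀ G (F : Finite G) → G ⊨ universally ax → Axiomatic layout τ (Edge G)
    axiomatic-in G F G⊨ = to (⊩axioms layout τ (Edge G)) (to (⊨-universally ax G F) G⊨)

-- Coincidence lemma and blocks of quantifiers.

module _ (M : Structure σ) where

  private variable
    ρ ρ′ : Assignment M

  mutual
    term-cong : (t : Term σ) → (∀ x → x ∈ᵗ t → ρ x ≡ ρ′ x) → ⟦_⟧ M t ρ ≡ ⟦_⟧ M t ρ′
    term-cong (var x)    h = h x here
    term-cong (app f ts) h = cong (funᴹ M f) (terms-cong ts λ x → h x ∘ there)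

    terms-cong : (ts : Vec (Term σ) n) → (∀ x → Any (x ∈ᵗ_) ts → ρ x ≡ ρ′ x) →
                 ⟦_⟧* M ts ρ ≡ ⟦_⟧* M ts ρ′
    terms-cong []       h = refl
    terms-cong (t ∷ ts) h = cong₂ _∷_ (term-cong t λ x → h x ∘ here) (terms-cong ts λ x → h x ∘ there)

  update-cong : ∀ {P : Var → Set} {x} a → (∀ y → y ≢ x × P y → ρ y ≡ ρ′ y) →
                ∀ y → P y → _[_↦_] M ρ x a y ≡ _[_↦_] M ρ′ x a y
  update-cong {ρ} {ρ′} {x = x} a h y p with x ≟ y
  ... | yes refl = trans (update-same M ρ x a) (sym (update-same M ρ′ x a))
  ... | no x≢y   = trans (update-other M ρ a x≢y)
                     (trans (h y (≢-sym x≢y , p)) (sym (update-other M ρ′ a x≢y)))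

  -- The usual coincidence lemma. It is needed because `⊨` ranges over all assignments, whereas the
  -- translation below fixes one colouring of the variables and so reaches only some of them.
  Sat-cong : ∀ φ → (∀ x → x FreeIn φ → ρ x ≡ ρ′ x) → Sat M ρ φ ⇔ Sat M ρ′ φ
  Sat-cong (s ≈′ t) h =
    let p = term-cong s λ x → h x ∘ inj₁ ; q = term-cong t λ x → h x ∘ inj₂
    in mk⇔ (λ e → trans (sym p) (trans e q)) (λ e → trans p (trans e (sym q)))
  Sat-cong (rel r ts) h =
    let p = terms-cong ts h in mk⇔ (subst (T ∘ relᴹ M r) p) (subst (T ∘ relᴹ M r) (sym p))
  Sat-cong (¬′ φ) h = let s = Sat-cong φ h in mk⇔ (_∘ from s) (_∘ to s)
  Sat-cong (φ ∧′ ψ) h =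
    let s = Sat-cong φ (λ x → h x ∘ inj₁) ; t = Sat-cong ψ (λ x → h x ∘ inj₂)
    in mk⇔ (λ (p , q) → to s p , to t q) (λ (p , q) → from s p , from t q)
  Sat-cong (φ ∨′ ψ) h =
    let s = Sat-cong φ (λ x → h x ∘ inj₁) ; t = Sat-cong ψ (λ x → h x ∘ inj₂)
    in mk⇔ (Sum.map (to s) (to t)) (Sum.map (from s) (from t))
  Sat-cong (all′ x φ) h =
    let s = λ a → Sat-cong φ (update-cong a h)
    in mk⇔ (λ f a → to (s a) (f a)) (λ f a → from (s a) (f a))
  Sat-cong (ex′ x φ) h =
    let s = λ a → Sat-cong φ (update-cong a h)
    in mk⇔ (λ (a , p) → a , to (s a) p) (λ (a , p) → a , from (s a) p)

  assign : Assignment M → Var → Vec (Carrier M) n → Assignment M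
  assign ρ s []      = ρ
  assign ρ s (d ∷ v) = assign (_[_↦_] M ρ s d) (suc s) v

  assign-< : ∀ (ρ : Assignment M) s (v : Vec (Carrier M) n) {y} → y < s → assign ρ s v y ≡ ρ y
  assign-< ρ s []      y<s = refl
  assign-< ρ s (d ∷ v) y<s = trans (assign-< _ (suc s) v (ℕ.m≤n⇒m≤1+n y<s))
    (update-other M ρ d (≢-sym (ℕ.<⇒≢ y<s)))

  assign-≥ : ∀ (ρ : Assignment M) s (v : Vec (Carrier M) n) {y} → s + n ≤ y → assign ρ s v y ≡ ρ y
  assign-≥         ρ s []      y≥ = refl
  assign-≥ {suc n} ρ s (d ∷ v) {y} y≥ =
    let y≥′ = subst (_≤ y) (ℕ.+-suc s n) y≥
    in trans (assign-≥ _ (suc s) v y≥′)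
         (update-other M ρ d (ℕ.<⇒≢ (ℕ.≤-trans (s≤s (ℕ.m≤m+n s n)) y≥′)))

  assign-lookup : ∀ (ρ : Assignment M) s (v : Vec (Carrier M) n) j → assign ρ s v (s + toℕ j) ≡ lookup v j
  assign-lookup ρ s (d ∷ v) zero rewrite ℕ.+-identityʳ s =
    trans (assign-< _ (suc s) v ℕ.≤-refl) (update-same M ρ s d)
  assign-lookup ρ s (d ∷ v) (suc j) rewrite ℕ.+-suc s (toℕ j) = assign-lookup _ (suc s) v j

alls exs : Var → ℕ → Formula σ → Formula σ
alls s zero    φ = φ
alls s (suc m) φ = all′ s (alls (suc s) m φ)
exs s zero    φ = φ
exs s (suc m) φ = ex′ s (exs (suc s) m φ)

module _ {M : Structure σ} where

  Sat-alls : ∀ {ρ s} m {φ} → Sat M ρ (alls s m φ) ⇔ ((v : Vec (Carrier M) m) → Sat M (assign M ρ s v) φ)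
  Sat-alls zero    = mk⇔ (λ { p [] → p }) (λ p → p [])
  Sat-alls (suc m) = mk⇔ (λ { p (d ∷ v) → to (Sat-alls m) (p d) v })
                         (λ p d → from (Sat-alls m) λ v → p (d ∷ v))

  Sat-exs : ∀ {ρ s} m {φ} → Sat M ρ (exs s m φ) ⇔ (∃ λ (v : Vec (Carrier M) m) → Sat M (assign M ρ s v) φ)
  Sat-exs zero    = mk⇔ (λ p → [] , p) (λ { ([] , p) → p })
  Sat-exs (suc m) = mk⇔
    (λ (d , p) → let v , q = to (Sat-exs m) p in d ∷ v , q)
    (λ { (d ∷ v , p) → d , from (Sat-exs m) (v , p) })

alls-free : ∀ {y s} m {φ : Formula σ} → y FreeIn alls s m φ → y FreeIn φ × (∀ (j : Fin m) → y ≢ s + toℕ j)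
alls-free zero f = f , λ ()
alls-free {s = s} (suc m) (y≢s , f) =
  let g , h = alls-free m f
  in g , λ { zero e → y≢s (trans e (ℕ.+-identityʳ s)) ; (suc j) e → h j (trans e (ℕ.+-suc s (toℕ j))) }

exs-free : ∀ {y s} m {φ : Formula σ} → y FreeIn exs s m φ → y FreeIn φ × (∀ (j : Fin m) → y ≢ s + toℕ j)
exs-free zero f = f , λ ()
exs-free {s = s} (suc m) (y≢s , f) =
  let g , h = exs-free m f
  in g , λ { zero e → y≢s (trans e (ℕ.+-identityʳ s)) ; (suc j) e → h j (trans e (ℕ.+-suc s (toℕ j))) }

conjunction-free : ∀ {y u} (φ : Fin n → Formula σ) → y FreeIn conjunction u φ → y ≡ u ⊎ ∃ λ i → y FreeIn φ i
conjunction-free {zero}  φ (inj₁ here) = inj₁ refl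
conjunction-free {zero}  φ (inj₂ here) = inj₁ refl
conjunction-free {suc n} φ (inj₁ f)    = inj₂ (zero , f)
conjunction-free {suc n} φ (inj₂ f)    = Sum.map₂ (λ (i , g) → suc i , g) (conjunction-free (φ ∘ suc) f)

disjunction-free : ∀ {y u} (φ : Fin n → Formula σ) → y FreeIn disjunction u φ → y ≡ u ⊎ ∃ λ i → y FreeIn φ i
disjunction-free {zero}  φ (inj₁ here) = inj₁ refl
disjunction-free {zero}  φ (inj₂ here) = inj₁ refl
disjunction-free {suc n} φ (inj₁ f)    = inj₂ (zero , f)
disjunction-free {suc n} φ (inj₂ f)    = Sum.map₂ (λ (i , g) → suc i , g) (disjunction-free (φ ∘ suc) f)

-- Graphs on nᵏ c vertices described over n points.

-- A graph with vertices Dᵏ × {0,…,C}, described inside D: a vertex variable x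
-- becomes the k variables x k, …, x k + (k - 1), and its colour γ x is kept
-- outside the formula, with one relation symbol for each pair of colours.
module Powers (K C : ℕ) where

  k : ℕ
  k = suc K

  vocabulary : Vocabulary
  vocabulary = record
    { #rel = suc C * suc C ; relArity = λ _ → k + k ; #fun = 0 ; funArity = λ () }

  Colouring : Set
  Colouring = Var → Fin (suc C)

  recolour : Colouring → Var → Fin (suc C) → Colouring
  recolour γ x p y = case x ≟ y of λ where
    (yes _) → p
    (no _)  → γ y

  coordinate-var : Var → Fin k → Var
  coordinate-var x j = x * k + toℕ j

  block : Var → Vec (Term vocabulary) k
  block x = tabulate (var ∘ coordinate-var x)

  equation : Var → Var → Fin k → Formula vocabulary
  equation x y j = var (coordinate-var x j) ≈′ var (coordinate-var y j)

  equal : Var → Var → Formula vocabulary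
  equal x y = conjunction 0 (equation x y)

  translate : Colouring → Formula graphVocabulary → Formula vocabulary
  translate γ (var x ≈′ var y) = case γ x Fin.≟ γ y of λ where
    (yes _) → equal x y
    -- Vertices of different colours are different.
    (no _)  → ¬′ tautology 0
  translate γ (rel zero (var x ∷ var y ∷ [])) = rel (combine (γ x) (γ y)) (block x ++ block y)
  translate γ (¬′ φ)     = ¬′ translate γ φ
  translate γ (φ ∧′ ψ)   = translate γ φ ∧′ translate γ ψ
  translate γ (φ ∨′ ψ)   = translate γ φ ∨′ translate γ ψ
  -- A vertex is a colour and k points: a finite conjunction runs through the colours, k quantifiers
  -- through the points.
  translate γ (all′ x φ) = conjunction 0 λ p → alls (x * k) k (translate (recolour γ x p) φ)
  translate γ (ex′ x φ)  = disjunction 0 λ p → exs (x * k) k (translate (recolour γ x p) φ)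

  variables-free : ∀ {y} (f : Fin n → Var) →
    Any (y ∈ᵗ_) (tabulate {A = Term vocabulary} (var ∘ f)) → ∃ λ j → y ≡ f j
  variables-free {suc n} f (here here) = zero , refl
  variables-free {suc n} f (there o)   = let j , e = variables-free (f ∘ suc) o in suc j , e

  block-free : ∀ {y} x x′ → Any (y ∈ᵗ_) (block x ++ block x′) →
    ∃ λ j → y ≡ coordinate-var x j ⊎ y ≡ coordinate-var x′ j
  block-free x x′ o with ++⁻ (block x) o
  ... | inj₁ f = let j , e = variables-free (coordinate-var x) f in j , inj₁ e
  ... | inj₂ f = let j , e = variables-free (coordinate-var x′) f in j , inj₂ e

  -- The exceptional variable 0 is the one that the constants true and false are written with; it
  -- can occur without coming from φ.
  translate-free : ∀ φ {γ y} → y FreeIn translate γ φ →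
    y ≡ 0 ⊎ ∃ λ x → ∃ λ j → x FreeIn φ × y ≡ coordinate-var x j
  translate-free (var x ≈′ var y) {γ} f with γ x Fin.≟ γ y
  translate-free (var x ≈′ var y) {γ} f | yes _ with conjunction-free (equation x y) f
  ... | inj₁ e               = inj₁ e
  ... | inj₂ (j , inj₁ here) = inj₂ (x , j , inj₁ here , refl)
  ... | inj₂ (j , inj₂ here) = inj₂ (y , j , inj₂ here , refl)
  translate-free (var x ≈′ var y) {γ} (inj₁ here) | no _ = inj₁ refl
  translate-free (var x ≈′ var y) {γ} (inj₂ here) | no _ = inj₁ refl
  translate-free (rel zero (var x ∷ var x′ ∷ [])) f with block-free x x′ f
  ... | j , inj₁ e = inj₂ (x , j , here here , e)
  ... | j , inj₂ e = inj₂ (x′ , j , there (here here) , e)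
  translate-free (¬′ φ) f = translate-free φ f
  translate-free (φ ∧′ ψ) (inj₁ f) = Sum.map₂ (λ (x , j , g , e) → x , j , inj₁ g , e) (translate-free φ f)
  translate-free (φ ∧′ ψ) (inj₂ f) = Sum.map₂ (λ (x , j , g , e) → x , j , inj₂ g , e) (translate-free ψ f)
  translate-free (φ ∨′ ψ) (inj₁ f) = Sum.map₂ (λ (x , j , g , e) → x , j , inj₁ g , e) (translate-free φ f)
  translate-free (φ ∨′ ψ) (inj₂ f) = Sum.map₂ (λ (x , j , g , e) → x , j , inj₂ g , e) (translate-free ψ f)
  translate-free (all′ x φ) {γ} f
    with conjunction-free (λ p → alls (x * k) k (translate (recolour γ x p) φ)) f
  ... | inj₁ e = inj₁ e
  ... | inj₂ (p , f′) with alls-free k f′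
  ... | g , h = Sum.map₂ (λ (z , j , g′ , e) → z , j , ((λ { refl → h j e }) , g′) , e) (translate-free φ g)
  translate-free (ex′ x φ) {γ} f
    with disjunction-free (λ p → exs (x * k) k (translate (recolour γ x p) φ)) f
  ... | inj₁ e = inj₁ e
  ... | inj₂ (p , f′) with exs-free k f′
  ... | g , h = Sum.map₂ (λ (z , j , g′ , e) → z , j , ((λ { refl → h j e }) , g′) , e) (translate-free φ g)

  module _ (M : Structure vocabulary) (G : Structure graphVocabulary)
    (code : Carrier G ↔ (Vec (Carrier M) k × Fin (suc C)))
    (⊩edge : ∀ {v p w q} → Edge G (Inverse.from code (v , p)) (Inverse.from code (w , q)) ⇔
                           T (relᴹ M (combine p q) (v ++ w))) where

    private
      D = Carrier M

      decode : Vec D k × Fin (suc C) → Carrier G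
      decode = Inverse.from code

      decode-injective : ∀ {u v} → decode u ≡ decode v → u ≡ v
      decode-injective {u} {v} e = trans (sym (Inverse.strictlyInverseˡ code u))
        (trans (cong (Inverse.to code) e) (Inverse.strictlyInverseˡ code v))

    entries : Assignment M → Var → Vec D k
    entries ρ x = tabulate (ρ ∘ coordinate-var x)

    record Codes (ρ : Assignment M) (γ : Colouring) (α : Assignment G) : Set where
      constructor codes
      field coded : ∀ x → α x ≡ decode (entries ρ x , γ x)
    open Codes

    entries-assign : ∀ ρ x v → entries (assign M ρ (x * k) v) x ≡ v
    entries-assign ρ x v = trans (tabulate-cong (assign-lookup M ρ (x * k) v)) (tabulate∘lookup v)

    -- Blocks of different variables are disjoint, since x < y implies x k + k ≤ y k.
    entries-assign-other : ∀ ρ {x y} v → x ≢ y → entries (assign M ρ (x * k) v) y ≡ entries ρ y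
    entries-assign-other ρ {x} {y} v x≢y = tabulate-cong other
      where
      other : ∀ j → assign M ρ (x * k) v (coordinate-var y j) ≡ ρ (coordinate-var y j)
      other j with ℕ.<-cmp x y
      ... | tri≈ _ x≡y _ = ⊥-elim (x≢y x≡y)
      ... | tri< x<y _ _ = assign-≥ M ρ (x * k) v (ℕ.≤-trans (ℕ.≤-reflexive (ℕ.+-comm (x * k) k))
              (ℕ.≤-trans (ℕ.*-monoˡ-≤ k x<y) (ℕ.m≤m+n (y * k) (toℕ j))))
      ... | tri> _ _ y<x = assign-< M ρ (x * k) v (ℕ.≤-trans (ℕ.+-monoʳ-< (y * k) (toℕ<n j))
              (ℕ.≤-trans (ℕ.≤-reflexive (ℕ.+-comm (y * k) k)) (ℕ.*-monoˡ-≤ k y<x)))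

    codes-update : ∀ {ρ γ α} → Codes ρ γ α → ∀ x v p →
      Codes (assign M ρ (x * k) v) (recolour γ x p) (_[_↦_] G α x (decode (v , p)))
    codes-update {ρ} {γ} {α} (codes h) x v p = codes updated
      where
      updated : ∀ y → _[_↦_] G α x (decode (v , p)) y ≡
        decode (entries (assign M ρ (x * k) v) y , recolour γ x p y)
      updated y with x ≟ y
      ... | yes refl = trans (update-same G α x _) (cong (λ v → decode (v , p)) (sym (entries-assign ρ x v)))
      ... | no x≢y   = trans (update-other G α _ x≢y)
        (trans (h y) (cong (λ v → decode (v , γ y)) (sym (entries-assign-other ρ v x≢y))))

    block-value : ∀ ρ x x′ → ⟦_⟧* M (block x ++ block x′) ρ ≡ entries ρ x ++ entries ρ x′
    block-value ρ x x′ = append (coordinate-var x)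
      where
      variables : ∀ {n} (f : Fin n → Var) → ⟦_⟧* M (tabulate (var ∘ f)) ρ ≡ tabulate (ρ ∘ f)
      variables {zero}  f = refl
      variables {suc n} f = cong (_ ∷_) (variables (f ∘ suc))
      append : ∀ {n} (f : Fin n → Var) →
        ⟦_⟧* M (tabulate (var ∘ f) ++ block x′) ρ ≡ tabulate (ρ ∘ f) ++ entries ρ x′
      append {zero}  f = variables (coordinate-var x′)
      append {suc n} f = cong (_ ∷_) (append (f ∘ suc))

    -- `code` is an arbitrary bijection because it is used in two ways: as the identity for a graph
    -- built on pairs, and as a mere enumeration for a given graph of the right size.
    Sat-translate : ∀ φ {ρ γ α} → Codes ρ γ α → Sat G α φ ⇔ Sat M ρ (translate γ φ)
    Sat-translate (var x ≈′ var y) {ρ} {γ} {α} c with γ x Fin.≟ γ y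
    ... | yes p = mk⇔ forth back
      where
      forth : α x ≡ α y → Sat M ρ (equal x y)
      forth e = from (Sat-conjunction (equation x y)) λ j →
        trans (sym (lookup∘tabulate (ρ ∘ coordinate-var x) j)) (trans (cong (λ v → lookup v j) (proj₁ (,-injective
          (decode-injective (trans (sym (coded c x)) (trans e (coded c y))))))) (lookup∘tabulate (ρ ∘ coordinate-var y) j))
      back : Sat M ρ (equal x y) → α x ≡ α y
      back s = trans (coded c x) (trans
        (cong₂ (λ v p → decode (v , p)) (tabulate-cong (to (Sat-conjunction (equation x y)) s)) p) (sym (coded c y)))
    ... | no ¬p = mk⇔
      (λ e _ → ¬p (proj₂ (,-injective (decode-injective (trans (sym (coded c x)) (trans e (coded c y)))))))
      (λ f → ⊥-elim (f refl))
    Sat-translate (rel zero (var x ∷ var y ∷ [])) {ρ} {γ} {α} c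
      rewrite coded c x | coded c y | block-value ρ x y = ⊩edge
    Sat-translate (¬′ φ) c = let s = Sat-translate φ c in mk⇔ (_∘ from s) (_∘ to s)
    Sat-translate (φ ∧′ ψ) c =
      let s = Sat-translate φ c ; t = Sat-translate ψ c
      in mk⇔ (λ (p , q) → to s p , to t q) (λ (p , q) → from s p , from t q)
    Sat-translate (φ ∨′ ψ) c =
      let s = Sat-translate φ c ; t = Sat-translate ψ c
      in mk⇔ (Sum.map (to s) (to t)) (Sum.map (from s) (from t))
    Sat-translate (all′ x φ) {ρ} {γ} {α} c = mk⇔
      (λ f → from (Sat-conjunction bodies) λ p → from (Sat-alls {M = M} k) λ v →
         to (Sat-translate φ (codes-update c x v p)) (f (decode (v , p))))
      (λ f a → let v , p = Inverse.to code a in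
         subst (λ a → Sat G (_[_↦_] G α x a) φ) (Inverse.strictlyInverseʳ code a)
           (from (Sat-translate φ (codes-update c x v p))
             (to (Sat-alls {M = M} k) (to (Sat-conjunction bodies) f p) v)))
      where bodies = λ p → alls (x * k) k (translate (recolour γ x p) φ)
    Sat-translate (ex′ x φ) {ρ} {γ} {α} c = mk⇔
      (λ (a , f) → let v , p = Inverse.to code a in
         from (Sat-disjunction bodies) (p , from (Sat-exs {M = M} k) (v ,
           to (Sat-translate φ (codes-update c x v p))
             (subst (λ a → Sat G (_[_↦_] G α x a) φ) (sym (Inverse.strictlyInverseʳ code a)) f))))
      (λ f → let p , g = to (Sat-disjunction bodies) f ; v , h = to (Sat-exs {M = M} k) g in
         decode (v , p) , from (Sat-translate φ (codes-update c x v p)) h)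
      where bodies = λ p → exs (x * k) k (translate (recolour γ x p) φ)

  unpack : {A : Set} → Fin (suc C * suc C) → Vec A (k + k) →
           (Vec A k × Fin (suc C)) × (Vec A k × Fin (suc C))
  unpack r u = let p , q = remQuot {suc C} (suc C) r in (take k u , p) , (drop k u , q)

  unpack-pack : {A : Set} (v : Vec A k) (p : Fin (suc C)) (w : Vec A k) (q : Fin (suc C)) →
                unpack (combine p q) (v ++ w) ≡ ((v , p) , (w , q))
  unpack-pack v p w q =
    let e , f = ++-injective (take k (v ++ w)) v (take++drop≡id k (v ++ w))
        pq    = remQuot-combine {suc C} {suc C} p q
    in cong₂ _,_ (cong₂ _,_ e (cong proj₁ pq)) (cong₂ _,_ f (cong proj₂ pq))

  module _ (ψ : Sentence graphVocabulary) where

    monochrome : Colouring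
    monochrome _ = zero

    -- The outer quantifier only binds the variable of the empty conjunctions.
    described : Sentence vocabulary
    described = record
      { formula = all′ 0 (translate monochrome (formula ψ))
      ; closed  = λ y (y≢0 , f) → case translate-free (formula ψ) {monochrome} f of λ where
          (inj₁ y≡0)             → y≢0 y≡0
          (inj₂ (x , _ , g , _)) → closed ψ x g
      }

    Spec-described : ∀ n → Spec described n ⇔ Spec ψ (n ^ k * suc C)
    Spec-described n = mk⇔ forth back
      where
      size : ∀ {D : Set} → D ↔ Fin n → (Vec D k × Fin (suc C)) ↔ Fin (n ^ k * suc C)
      size F = ↔-trans (Vec-finite F k ×-↔ ↔-refl) (↔-sym *↔×)

      forth : Spec described n → Spec ψ (n ^ k * suc C)
      forth (M , F , M⊨) = G , size F , λ α →
        to (Sat-cong G (formula ψ) λ x f → ⊥-elim (closed ψ x f))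
          (from (Sat-translate M G ↔-refl (mk⇔ id id) (formula ψ) (codes λ x → refl)) (M⊨ (λ _ → nonempty M) (nonempty M)))
        where
        G : Structure graphVocabulary
        G = record
          { Carrier  = Vec (Carrier M) k × Fin (suc C)
          ; nonempty = replicate k (nonempty M) , zero
          ; relᴹ     = λ { _ ((v , p) ∷ (w , q) ∷ []) → relᴹ M (combine p q) (v ++ w) }
          ; funᴹ     = λ ()
          }

      back : Spec ψ (n ^ k * suc C) → Spec described n
      back (G , F , G⊨) = M , ↔-refl , λ ρ d →
        to (Sat-translate M G code (λ {v} {p} {w} {q} → edges v p w q) (formula ψ) (codes λ x → refl)) (G⊨ _)
        where
        code : Carrier G ↔ (Vec (Fin n) k × Fin (suc C))
        -- Any numbering of the vertices serves, since the relations for the pairs of colours can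
        -- describe an arbitrary graph.
        code = ↔-trans F (↔-sym (size ↔-refl))
        M : Structure vocabulary
        M = record
          { Carrier  = Fin n
          -- The graph has a vertex, and its code has a first entry because k is positive.
          ; nonempty = head (proj₁ (Inverse.to code (nonempty G)))
          ; relᴹ     = λ r u → let x , y = unpack r u in
              relᴹ G zero (Inverse.from code x ∷ Inverse.from code y ∷ [])
          ; funᴹ     = λ ()
          }
        edges : ∀ v p w q → Edge G (Inverse.from code (v , p)) (Inverse.from code (w , q)) ⇔
          T (relᴹ M (combine p q) (v ++ w))
        edges v p w q =
          subst (λ u → T (relᴹ G zero (Inverse.from code (v , p) ∷ Inverse.from code (w , q) ∷ [])) ⇔
                       T (relᴹ G zero (Inverse.from code (proj₁ u) ∷ Inverse.from code (proj₂ u) ∷ [])))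
            (sym (unpack-pack v p w q)) (mk⇔ id id)

-- Sizes of the form nᵏ c and closure under complement.

Spec-positive : {σ : Vocabulary} (φ : Sentence σ) {n : ℕ} → Spec φ n → 1 ≤ n
Spec-positive φ {zero}  (M , F , _) = case Inverse.to F (nonempty M) of λ ()
Spec-positive φ {suc n} _           = s≤s z≤n

^-distribʳ-* : ∀ m n o → (m * n) ^ o ≡ m ^ o * n ^ o
^-distribʳ-* m n zero    = refl
^-distribʳ-* m n (suc o) = trans (cong (m * n *_) (^-distribʳ-* m n o))
  (ℕ.[m*n]*[o*p]≡[m*o]*[n*p] m n (m ^ o) (n ^ o))

compose-powers : ∀ K C K′ C′ → ∃ λ K″ → ∃ λ C″ → ∀ n →
  (n ^ suc K * suc C) ^ suc K′ * suc C′ ≡ n ^ suc K″ * suc C″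
-- The exponent (K + 1)(K′ + 1) is by computation the successor of K′ + K (K′ + 1). The new factor c
-- is positive, hence the successor of `pred c`.
compose-powers K C K′ C′ = K′ + K * suc K′ , pred c , λ n → begin
  (n ^ suc K * suc C) ^ suc K′ * suc C′            ≡⟨ cong (_* suc C′) (^-distribʳ-* (n ^ suc K) (suc C) (suc K′)) ⟩
  (n ^ suc K) ^ suc K′ * suc C ^ suc K′ * suc C′   ≡⟨ ℕ.*-assoc ((n ^ suc K) ^ suc K′) (suc C ^ suc K′) (suc C′) ⟩
  (n ^ suc K) ^ suc K′ * c                         ≡⟨ cong₂ _*_ (ℕ.^-*-assoc n (suc K) (suc K′)) (sym (ℕ.suc-pred c {{c≢0}})) ⟩
  n ^ (suc K * suc K′) * suc (pred c)              ∎
  where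
  open ≡-Reasoning
  c = suc C ^ suc K′ * suc C′
  c≢0 = ℕ.m*n≢0 (suc C ^ suc K′) (suc C′) {{ℕ.m^n≢0 (suc C) (suc K′)}}

Spec-powers-isSpectrum : {σ : Vocabulary} (ψ : Sentence σ) → ∀ K C →
  IsSpectrum (λ n → Spec ψ (n ^ suc K * suc C))
Spec-powers-isSpectrum ψ K C =
  let open GraphReduction (graph-reduction ψ) renaming (K to K′; C to C′; sentence to ψ′)
      K″ , C″ , size = compose-powers K C K′ C′
      open Powers K″ C″
      iff : ∀ n → Spec (described ψ′) n ⇔ Spec ψ′ ((n ^ suc K * suc C) ^ suc K′ * suc C′)
      iff = λ n → subst (λ m → Spec (described ψ′) n ⇔ Spec ψ′ m) (sym (size n)) (Spec-described ψ′ n)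
  in vocabulary , described ψ′ ,
     (λ {n} p → from (iff n) (to (spec _) p)) , (λ {n} p → from (spec _) (to (iff n) p))

corollary1p2 : ((σ : Vocabulary) (φ : Sentence σ) → IsSpectrum (CoSpec φ))
    ⇔
    ((φ : Sentence graphVocabulary) → ThreeVariable φ →
    FiniteModelsAreBipartiteGraphs φ → IsSpectrum (CoSpec φ))
corollary1p2 = mk⇔ (λ closed φ _ _ → closed graphVocabulary φ) back
  where
  back : ((φ : Sentence graphVocabulary) → ThreeVariable φ →
          FiniteModelsAreBipartiteGraphs φ → IsSpectrum (CoSpec φ)) →
         (σ : Vocabulary) (φ : Sentence σ) → IsSpectrum (CoSpec φ)
  back closed σ φ =
    let open GraphReduction (graph-reduction φ)
        _ , ψ , co⊆ , ⊆co = closed sentence three-variable bipartite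
        τ , χ , powers⊆ , ⊆powers = Spec-powers-isSpectrum ψ K C
        -- Complements are taken within the positive numbers, so positivity has to pass from n to nᵏ
        -- c.
        positive = λ n (1≤n : 1 ≤ n) → ℕ.*-mono-≤ (ℕ.^-monoˡ-≤ (suc K) 1≤n) (s≤s (z≤n {C}))
    in τ , χ ,
       (λ {n} (1≤n , ¬p) → powers⊆ (co⊆
         (subst (_≤ n ^ suc K * suc C) (cong (_* 1) (ℕ.^-zeroˡ (suc K))) (positive n 1≤n) , ¬p ∘ from (spec n)))) ,
       (λ {n} p → Spec-positive χ p , proj₂ (⊆co (⊆powers p)) ∘ to (spec n))
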